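{- Let $n$ be a large odd integer, let $d\ge 1$ and $1\le k\le d$ be integers, and let $E\subset\mathbb{Z}_n^d$. Suppose that \[ |E| \gg \frac{\sqrt{\tau(n)}\, n^{d+\frac{k-1}{2}}}{\gamma(n)^{(d-1)/2}}. \] Then $E$ determines a positive proportion of all $k$-simplices, i.e. \[ |\mathcal{T}_k(E)| \gg n^{\binom{k+1}{2}}. \]
   Context: $\mathbb{Z}_n$ is the ring of residues modulo $n$. For $x\in\mathbb{Z}_n^d$, $\|x\|=x_1^2+\dots+x_d^2\in\mathbb{Z}_n$. $\gamma(n)$ is the smallest prime divisor of $n$ and $\tau(n)$ is the number of divisors of $n$. A $k$-simplex type is a tuple $l_k=(t_{i,j})_{0\le i<j\le k}\in\mathbb{Z}_n^{\binom{k+1}{2}}$; the set of $k$-simplices determined by $E$ is $\mathcal{T}_k(E)=\{l_k : \exists\, x_0,\dots,x_k\in E \text{ with } \|x_i-x_j\|=t_{i,j} \text{ for all } 0\le i<j\le k\}$. Notation: $X\gg Y$ means $X\ge CY$ for some constant $C>0$ independent of $n$ and $E$ (it may depend on $d,k$); a hypothesis $|E|\gg Y$ means $|E|\ge CY$ for a suitable sufficiently large such constant $C$. -}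

module Defs where

open import Data.Nat using (ℕ; zero; suc; _+_; _*_; _∸_; _^_; _≤_; NonZero)
open import Data.Nat.DivMod using (_%_)
open import Data.Nat.Divisibility using (_∣?_)
open import Data.Fin as Fin using (Fin; toℕ)
open import Data.Vec using (Vec; zipWith; sum)
open import Data.List using (List; length; filter; map; upTo)
open import Data.List.Membership.Propositional using (_∈_)
open import Data.List.Relation.Unary.AllPairs using (AllPairs)
open import Data.Product using (Σ; ∃; _×_)
open import Relation.Binary.PropositionalEquality using (_≡_; _≢_)

τ : ℕ → ℕ
τ n = length (filter (_∣? n) (map suc (upTo n)))

Point : ℕ → ℕ → Set
Point n d = Vec (Fin n) d

-- (a - b)^2 computed on representatives; a - b ≡ a + n - b (mod n).
sqDiff : (n : ℕ) → Fin n → Fin n → ℕ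
sqDiff n a b = (toℕ a + n ∸ toℕ b) * (toℕ a + n ∸ toℕ b)

dist : (n : ℕ) .{{_ : NonZero n}} {d : ℕ} → Point n d → Point n d → ℕ
dist n x y = sum (zipWith (sqDiff n) x y) % n

-- A k-simplex type: entries t_{i,j} for 0 ≤ i < j ≤ k (residues, as naturals).
SimplexType : ℕ → Set
SimplexType k = (i j : Fin (suc k)) → i Fin.< j → ℕ

Determined : (n : ℕ) .{{_ : NonZero n}} {d : ℕ} (k : ℕ) → List (Point n d) → SimplexType k → Set
Determined n {d} k E t =
  Σ (Fin (suc k) → Point n d) λ xs →
    ((i : Fin (suc k)) → xs i ∈ E) ×
    ((i j : Fin (suc k)) (p : i Fin.< j) → t i j p ≡ dist n (xs i) (xs j))

DifferentTypes : {k : ℕ} → SimplexType k → SimplexType k → Set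
DifferentTypes {k} s t = Σ (Fin (suc k)) λ i → Σ (Fin (suc k)) λ j → Σ (i Fin.< j) λ p → s i j p ≢ t i j p

{-# OPTIONS --safe #-}
module Submission where

open import Defs
open import Data.Nat
open import Data.Nat.Properties
open import Data.Nat.Combinatorics using (_C_; nC1≡n; nCk+nC[k+1]≡[n+1]C[k+1])
open import Data.Nat.Coprimality using (Coprime; coprime-divisor)
open import Data.Nat.DivMod using (_%_; _/_; m≡m%n+[m/n]*n; m%n<n)
open import Data.Nat.Divisibility
open import Data.Nat.GCD using (gcd; gcd[m,n]∣m; gcd[m,n]∣n; gcd-greatest; c*gcd[m,n]≡gcd[cm,cn]; gcd-zeroˡ)
open import Data.Nat.ListAction using (sum; product)
open import Data.Nat.ListAction.Properties using (sum-++)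
open import Data.Nat.Primality using (Prime; prime⇒nonZero; irreducible[2])
open import Data.Nat.Primality.Factorisation using (factorise)
open import Data.Nat.Tactic.RingSolver using (solve-∀)
open import Data.Integer as ℤ using (ℤ; +_; ∣_∣)
import Data.Integer.Properties as ℤ
import Data.Integer.Divisibility.Signed as ℤ
import Data.Integer.Tactic.RingSolver as ℤ-Solver
open import Data.Fin as Fin using (Fin; toℕ; zero; suc)
open import Data.Fin.Properties using (toℕ<n)
open import Data.List using (List; []; _∷_; _++_; length; map; filter; concatMap; cartesianProductWith;
  upTo; applyUpTo; tabulate; allFin)
open import Data.List.Properties using (map-++; map-∘; map-tabulate; map-upTo; map-applyUpTo;
  length-upTo; length-tabulate; length-++; length-map)
open import Data.List.Membership.Propositional using (_∈_; find)
open import Data.List.Membership.Propositional.Properties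
open import Data.List.Relation.Binary.Sublist.Propositional using (_⊆_)
open import Data.List.Relation.Binary.Sublist.Propositional.Properties using (filter-⊆; length-mono-≤)
  renaming (filter⁺ to ⊆-filter⁺)
open import Data.List.Relation.Unary.Any using (here; there)
open import Data.List.Relation.Unary.All as All using (All; []; _∷_)
import Data.List.Relation.Unary.All.Properties as All
open import Data.List.Relation.Unary.AllPairs as AllPairs using (AllPairs; []; _∷_)
import Data.List.Relation.Unary.AllPairs.Properties as AllPairs
open import Data.List.Relation.Unary.Unique.Propositional using (Unique)
open import Data.List.Relation.Unary.Unique.Propositional.Properties using (upTo⁺; filter⁺; map⁺; concat⁺)
open import Data.Product using (_,_; _×_; Σ; proj₂)
open import Data.Sum using (inj₁; inj₂)
open import Data.Unit using (⊤; tt)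
open import Data.Vec as Vec using (Vec; []; _∷_; zipWith; lookup)
open import Data.Vec.Properties using (lookup-map; ∷-injectiveˡ; ∷-injectiveʳ)
open import Function using (_∘_; id)
open import Level using (0ℓ)
open import Relation.Binary.PropositionalEquality
open import Relation.Nullary using (Dec; yes; no; ¬_; contradiction)
open import Relation.Unary using (Pred; Decidable)

-- Let e = |E| and c = γ^(d-1). The points x equidistant from y and y′ solve a linear congruence whose
-- coefficients have gcd h with n, so there are at most n^(d-1) h of them; as h = 1 or h ≥ γ, and the sum
-- of h^d over all y′ is at most τ(n) n^d, there are on average about n^(d-1). Hence, for S, E ⊆ ℤ_n^d,
--     c n · #{(x, y, y′) ∈ E × S × S : ‖y - x‖ = ‖y′ - x‖} ≤ c e |S|² + τ(n) n^(2d) |S|,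
-- and iterating over the fibres S = {y : ‖y - x‖ = s} bounds the number of (x₁, …, xⱼ, y, y′) ∈ E^(j+2)
-- with ‖y - xᵢ‖ = ‖y′ - xᵢ‖ for all i by a constant times e^(j+2) / n^j, since e is large. By Cauchy–Schwarz, for any
-- F ⊆ E^(j+1) of positive density, a positive proportion of (x₁, …, xⱼ) ∈ E^j admit at least
-- a constant times n^j distance vectors (‖y - xᵢ‖)ᵢ with (y, x₁, …, xⱼ) ∈ F. Induction on j, applied to
-- the set of these tuples, then counts the types.

variable
  A B : Set

-- Finite sums over lists

∑ : List A → (A → ℕ) → ℕ
∑ xs f = sum (map f xs)

infixr 8 ∑
syntax ∑ xs (λ x → e) = ∑[ x ← xs ] e

∑-cong : ∀ (xs : List A) {f g : A → ℕ} → (∀ x → f x ≡ g x) → ∑ xs f ≡ ∑ xs g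
∑-cong []       f≡g = refl
∑-cong (x ∷ xs) f≡g = cong₂ _+_ (f≡g x) (∑-cong xs f≡g)

∑-mono : ∀ (xs : List A) {f g : A → ℕ} → (∀ x → f x ≤ g x) → ∑ xs f ≤ ∑ xs g
∑-mono []       f≤g = z≤n
∑-mono (x ∷ xs) f≤g = +-mono-≤ (f≤g x) (∑-mono xs f≤g)

∑-mono-∈ : ∀ (xs : List A) {f g : A → ℕ} → (∀ {x} → x ∈ xs → f x ≤ g x) → ∑ xs f ≤ ∑ xs g
∑-mono-∈ []       f≤g = z≤n
∑-mono-∈ (x ∷ xs) f≤g = +-mono-≤ (f≤g (here refl)) (∑-mono-∈ xs (f≤g ∘ there))

∑-+ : ∀ (xs : List A) (f g : A → ℕ) → ∑[ x ← xs ] (f x + g x) ≡ ∑ xs f + ∑ xs g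
∑-+ []       f g = refl
∑-+ (x ∷ xs) f g = trans (cong₂ _+_ refl (∑-+ xs f g)) (interchange (f x) (g x) _ _)
  where
  interchange : ∀ a b c d → a + b + (c + d) ≡ a + c + (b + d)
  interchange = solve-∀

∑-*ˡ : ∀ (xs : List A) c (f : A → ℕ) → ∑[ x ← xs ] (c * f x) ≡ c * ∑ xs f
∑-*ˡ []       c f = sym (*-zeroʳ c)
∑-*ˡ (x ∷ xs) c f = trans (cong₂ _+_ refl (∑-*ˡ xs c f)) (sym (*-distribˡ-+ c (f x) _))

∑-*ʳ : ∀ (xs : List A) (f : A → ℕ) c → ∑[ x ← xs ] (f x * c) ≡ ∑ xs f * c
∑-*ʳ xs f c = trans (∑-cong xs λ x → *-comm (f x) c) (trans (∑-*ˡ xs c f) (*-comm c _))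

∑-const : ∀ (xs : List A) c → ∑[ x ← xs ] c ≡ length xs * c
∑-const []       c = refl
∑-const (x ∷ xs) c = cong₂ _+_ refl (∑-const xs c)

∑-swap : ∀ (xs : List A) (ys : List B) (f : A → B → ℕ) →
         ∑[ x ← xs ] ∑[ y ← ys ] f x y ≡ ∑[ y ← ys ] ∑[ x ← xs ] f x y
∑-swap []       ys f = sym (trans (∑-const ys 0) (*-zeroʳ (length ys)))
∑-swap (x ∷ xs) ys f = trans (cong₂ _+_ refl (∑-swap xs ys f))
                             (sym (∑-+ ys (f x) λ y → ∑[ x ← xs ] f x y))

∑-++ : ∀ (xs ys : List A) (f : A → ℕ) → ∑ (xs ++ ys) f ≡ ∑ xs f + ∑ ys f
∑-++ xs ys f = trans (cong sum (map-++ f xs ys)) (sum-++ (map f xs) (map f ys))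

∑-map : ∀ (g : A → B) (xs : List A) (f : B → ℕ) → ∑ (map g xs) f ≡ ∑ xs (f ∘ g)
∑-map g xs f = cong sum (sym (map-∘ xs))

∑-∈ : ∀ {xs : List A} {x} (f : A → ℕ) → x ∈ xs → f x ≤ ∑ xs f
∑-∈ f (here refl)  = m≤m+n _ _
∑-∈ f (there x∈xs) = ≤-trans (∑-∈ f x∈xs) (m≤n+m _ _)

∑-upTo-suc : ∀ n (f : ℕ → ℕ) → ∑ (upTo (suc n)) f ≡ f 0 + ∑ (upTo n) (f ∘ suc)
∑-upTo-suc n f = cong (λ xs → f 0 + sum xs)
  (trans (map-applyUpTo suc f n) (sym (map-upTo (f ∘ suc) n)))

∑-upTo-+ : ∀ m n (f : ℕ → ℕ) → ∑ (upTo (m + n)) f ≡ ∑ (upTo m) f + ∑[ i ← upTo n ] f (m + i)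
∑-upTo-+ zero    n f = refl
∑-upTo-+ (suc m) n f
  rewrite ∑-upTo-suc (m + n) f | ∑-upTo-suc m f | ∑-upTo-+ m n (f ∘ suc)
  = sym (+-assoc (f 0) _ _)

∑-allFin : ∀ n (f : ℕ → ℕ) → ∑[ i ← allFin n ] f (toℕ i) ≡ ∑ (upTo n) f
∑-allFin n f = trans (cong sum (map-tabulate {n = n} id (f ∘ toℕ)))
                       (trans (tabulate≡applyUpTo n f) (sym (cong sum (map-upTo f n))))
  where
  tabulate≡applyUpTo : ∀ n (f : ℕ → ℕ) → sum (tabulate {n = n} (f ∘ toℕ)) ≡ sum (applyUpTo f n)
  tabulate≡applyUpTo zero    f = refl
  tabulate≡applyUpTo (suc n) f = cong₂ _+_ refl (tabulate≡applyUpTo n (f ∘ suc))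

-- Delete from `ys` one occurrence of the head of `xs`; as `xs` has no repetitions, its tail still
-- lies in what remains.
∑-⊆ : ∀ {xs ys : List A} (f : A → ℕ) → Unique xs → (∀ {x} → x ∈ xs → x ∈ ys) → ∑ xs f ≤ ∑ ys f
∑-⊆ {xs = []} f _ _ = z≤n
∑-⊆ {xs = x ∷ xs} {ys} f (x∉xs ∷ xs!) xs⊆ys with as , bs , refl ← ∈-∃++ (xs⊆ys (here refl)) = begin
  f x + ∑ xs f              ≤⟨ +-monoʳ-≤ (f x) (∑-⊆ f xs! xs⊆) ⟩
  f x + ∑ (as ++ bs) f      ≡⟨ cong₂ _+_ refl (∑-++ as bs f) ⟩
  f x + (∑ as f + ∑ bs f)   ≡⟨ rotate (f x) (∑ as f) (∑ bs f) ⟩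
  ∑ as f + (f x + ∑ bs f)   ≡⟨ ∑-++ as (x ∷ bs) f ⟨
  ∑ (as ++ x ∷ bs) f        ∎
  where
  open ≤-Reasoning
  rotate : ∀ a b c → a + (b + c) ≡ b + (a + c)
  rotate = solve-∀
  xs⊆ : ∀ {y} → y ∈ xs → y ∈ as ++ bs
  xs⊆ y∈xs with ∈-++⁻ as (xs⊆ys (there y∈xs))
  ... | inj₁ y∈as         = ∈-++⁺ˡ y∈as
  ... | inj₂ (here refl)  = contradiction refl (All.lookup x∉xs y∈xs)
  ... | inj₂ (there y∈bs) = ∈-++⁺ʳ as y∈bs

-- Indicators and counting

𝟙 : ∀ {P : Set} → Dec P → ℕ
𝟙 (yes _) = 1
𝟙 (no _)  = 0

𝟙≤1 : ∀ {P : Set} (P? : Dec P) → 𝟙 P? ≤ 1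
𝟙≤1 (yes _) = ≤-refl
𝟙≤1 (no _)  = z≤n

𝟙-yes : ∀ {P : Set} (P? : Dec P) → P → 𝟙 P? ≡ 1
𝟙-yes (yes _) _ = refl
𝟙-yes (no ¬p) p = contradiction p ¬p

𝟙-no : ∀ {P : Set} (P? : Dec P) → ¬ P → 𝟙 P? ≡ 0
𝟙-no (yes p) ¬p = contradiction p ¬p
𝟙-no (no _)  _  = refl

𝟙-mono : ∀ {P Q : Set} (P? : Dec P) (Q? : Dec Q) → (P → Q) → 𝟙 P? ≤ 𝟙 Q?
𝟙-mono (yes p) Q? P⇒Q = ≤-reflexive (sym (𝟙-yes Q? (P⇒Q p)))
𝟙-mono (no _)  Q? P⇒Q = z≤n

length-filter≡∑ : ∀ {P : Pred A _} (P? : Decidable P) xs → length (filter P? xs) ≡ ∑ xs (𝟙 ∘ P?)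
length-filter≡∑ P? [] = refl
length-filter≡∑ P? (x ∷ xs) with P? x
... | yes _ = cong suc (length-filter≡∑ P? xs)
... | no _  = length-filter≡∑ P? xs

∑-𝟙≤1 : ∀ {P : Pred A _} (P? : Decidable P) {xs} → Unique xs →
        (∀ {x y} → x ∈ xs → y ∈ xs → P x → P y → x ≡ y) → ∑ xs (𝟙 ∘ P?) ≤ 1
∑-𝟙≤1 P? [] _ = z≤n
∑-𝟙≤1 P? {x ∷ xs} (x∉xs ∷ xs!) unique with P? x
... | no _   = ∑-𝟙≤1 P? xs! λ p q → unique (there p) (there q)
... | yes px = ≤-reflexive (cong suc (rest x∉xs λ q → unique (here refl) (there q) px))
  where
  rest : ∀ {ys} → All (x ≢_) ys → (∀ {y} → y ∈ ys → _ → x ≡ y) → ∑ ys (𝟙 ∘ P?) ≡ 0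
  rest [] _ = refl
  rest {y ∷ ys} (x≢y ∷ x∉ys) only =
    cong₂ _+_ (𝟙-no (P? y) (x≢y ∘ only (here refl))) (rest x∉ys (only ∘ there))

-- Tuples with entries in a list

tuples : List A → ∀ k → List (Vec A k)
tuples xs zero    = [] ∷ []
tuples xs (suc k) = cartesianProductWith _∷_ xs (tuples xs k)

∑-tuples-suc : ∀ (xs : List A) k (f : Vec A (suc k) → ℕ) →
               ∑ (tuples xs (suc k)) f ≡ ∑[ x ← xs ] ∑[ v ← tuples xs k ] f (x ∷ v)
∑-tuples-suc {A} xs k f = go xs
  where
  go : ∀ (ys : List A) → ∑ (cartesianProductWith _∷_ ys (tuples xs k)) f
                         ≡ ∑[ y ← ys ] ∑[ v ← tuples xs k ] f (y ∷ v)
  go []       = refl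
  go (y ∷ ys) = trans (∑-++ (map (y ∷_) (tuples xs k)) _ f)
                      (cong₂ _+_ (∑-map (y ∷_) (tuples xs k) f) (go ys))

length≡∑ : ∀ (xs : List A) → length xs ≡ ∑[ x ← xs ] 1
length≡∑ xs = sym (trans (∑-const xs 1) (*-identityʳ _))

length-tuples : ∀ (xs : List A) k → length (tuples xs k) ≡ length xs ^ k
length-tuples xs zero    = refl
length-tuples xs (suc k) = begin
  length (tuples xs (suc k))              ≡⟨ length≡∑ (tuples xs (suc k)) ⟩
  ∑[ v ← tuples xs (suc k) ] 1            ≡⟨ ∑-tuples-suc xs k _ ⟩
  (∑[ x ← xs ] ∑[ v ← tuples xs k ] 1)    ≡⟨ ∑-const xs _ ⟩
  length xs * ∑[ v ← tuples xs k ] 1      ≡⟨ cong (length xs *_) (length≡∑ (tuples xs k)) ⟨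
  length xs * length (tuples xs k)        ≡⟨ cong (length xs *_) (length-tuples xs k) ⟩
  length xs ^ suc k                       ∎
  where open ≡-Reasoning

∈-tuples-allFin : ∀ {n k} (v : Vec (Fin n) k) → v ∈ tuples (allFin n) k
∈-tuples-allFin []      = here refl
∈-tuples-allFin (x ∷ v) = ∈-cartesianProductWith⁺ _∷_ (∈-allFin x) (∈-tuples-allFin v)

-- The Cauchy-Schwarz inequality over the natural numbers

square-cancel-≤ : ∀ a b → a * a ≤ b * b → a ≤ b
square-cancel-≤ a b a²≤b² = ≮⇒≥ λ b<a → <⇒≱ (*-mono-< b<a b<a) a²≤b²

-- Here `z` stands for a lower bound of √(xy), which avoids roots. The core is 4xy ≤ (x + y)², with
-- gap (x - y)²; writing the larger number as `x + k` avoids subtraction.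
am-gm : ∀ x y z → z * z ≤ x * y → 2 * z ≤ x + y
am-gm x y z z²≤xy = square-cancel-≤ _ _ (begin
  2 * z * (2 * z)    ≡⟨ four z ⟩
  4 * (z * z)        ≤⟨ *-monoʳ-≤ 4 z²≤xy ⟩
  4 * (x * y)        ≤⟨ 4xy≤[x+y]² ⟩
  (x + y) * (x + y)  ∎)
  where
  open ≤-Reasoning
  four : ∀ z → 2 * z * (2 * z) ≡ 4 * (z * z)
  four = solve-∀
  square-gap : ∀ x k → (x + (x + k)) * (x + (x + k)) ≡ 4 * (x * (x + k)) + k * k
  square-gap = solve-∀
  ordered : ∀ x y → x ≤ y → 4 * (x * y) ≤ (x + y) * (x + y)
  ordered x y x≤y with k , refl ← m≤n⇒∃[o]m+o≡n x≤y =
    ≤-trans (m≤m+n _ (k * k)) (≤-reflexive (sym (square-gap x k)))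
  4xy≤[x+y]² : 4 * (x * y) ≤ (x + y) * (x + y)
  4xy≤[x+y]² with ≤-total x y
  ... | inj₁ x≤y = ordered x y x≤y
  ... | inj₂ y≤x = subst₂ (λ s t → 4 * s ≤ t * t) (*-comm y x) (+-comm y x) (ordered y x y≤x)

-- The usual inequality is the case a² = r q; the slack lets a be bounded instead of computed.
cauchy-schwarz : ∀ (xs : List A) (a r q : A → ℕ) → (∀ x → a x * a x ≤ r x * q x) →
                 ∑ xs a * ∑ xs a ≤ ∑ xs r * ∑ xs q
cauchy-schwarz []       a r q a²≤rq = z≤n
cauchy-schwarz (x ∷ xs) a r q a²≤rq = begin
  (a x + S) * (a x + S)                      ≡⟨ square (a x) S ⟩
  a x * a x + 2 * (a x * S) + S * S          ≤⟨ +-mono-≤ (+-mono-≤ (a²≤rq x) cross) ih ⟩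
  r x * q x + (r x * Q + R * q x) + R * Q    ≡⟨ expand (r x) (q x) R Q ⟩
  (r x + R) * (q x + Q)                      ∎
  where
  open ≤-Reasoning
  S = ∑ xs a
  R = ∑ xs r
  Q = ∑ xs q
  ih : S * S ≤ R * Q
  ih = cauchy-schwarz xs a r q a²≤rq
  square : ∀ a s → (a + s) * (a + s) ≡ a * a + 2 * (a * s) + s * s
  square = solve-∀
  expand : ∀ r q s t → r * q + (r * t + s * q) + s * t ≡ (r + s) * (q + t)
  expand = solve-∀
  regroup : ∀ a b c d → a * b * (c * d) ≡ a * c * (b * d)
  regroup = solve-∀
  regroup′ : ∀ a b c d → a * b * (c * d) ≡ a * d * (c * b)
  regroup′ = solve-∀
  -- The products `r x * Q` and `R * q x` multiply to `(r x * q x) * (R * Q)`, which dominates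
  -- `(a x * S)²` by the hypothesis and the induction.
  cross : 2 * (a x * S) ≤ r x * Q + R * q x
  cross = am-gm (r x * Q) (R * q x) (a x * S) (begin
    a x * S * (a x * S)      ≡⟨ regroup (a x) S (a x) S ⟩
    a x * a x * (S * S)      ≤⟨ *-mono-≤ (a²≤rq x) ih ⟩
    r x * q x * (R * Q)      ≡⟨ regroup′ (r x) (q x) R Q ⟩
    r x * Q * (R * q x)      ∎)

-- Linear congruences

≡-mod⇒≡ : ∀ {m i j} → i < m → j < m → m ∣ ∣ + i ℤ.- + j ∣ → i ≡ j
≡-mod⇒≡ {m} {i} {j} i<m j<m m∣i-j =
  ℤ.+-injective (ℤ.i-j≡0⇒i≡j (+ i) (+ j) (ℤ.∣i∣≡0⇒i≡0 (n∣m<n⇒m≡0 m∣i-j small)))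
  where
  open ≤-Reasoning
  small : ∣ + i ℤ.- + j ∣ < m
  small = begin-strict
    ∣ + i ℤ.- + j ∣   ≡⟨ cong ∣_∣ (ℤ.m-n≡m⊖n i j) ⟩
    ∣ i ℤ.⊖ j ∣       ≤⟨ ℤ.∣m⊝n∣≤m⊔n i j ⟩
    i ⊔ j             <⟨ ⊔-lub i<m j<m ⟩
    m                 ∎
  n∣m<n⇒m≡0 : ∀ {n k} → n ∣ k → k < n → k ≡ 0
  n∣m<n⇒m≡0 {n} {zero}  _   _   = refl
  n∣m<n⇒m≡0 {n} {suc k} n∣k k<n = contradiction n∣k (>⇒∤ k<n)

-- Cut the range into `q` blocks of length `m`; each block holds at most one point.
∑-𝟙-spaced : ∀ m q {P : Pred ℕ _} (P? : Decidable P) →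
             (∀ i j → P i → P j → m ∣ ∣ + i ℤ.- + j ∣) → ∑ (upTo (q * m)) (𝟙 ∘ P?) ≤ q
∑-𝟙-spaced m zero    P? spaced = z≤n
∑-𝟙-spaced m (suc q) P? spaced = begin
  ∑ (upTo (m + q * m)) (𝟙 ∘ P?)
    ≡⟨ ∑-upTo-+ m (q * m) _ ⟩
  ∑ (upTo m) (𝟙 ∘ P?) + ∑[ i ← upTo (q * m) ] 𝟙 (P? (m + i))
    ≤⟨ +-mono-≤ first (∑-𝟙-spaced m q (λ i → P? (m + i)) shifted) ⟩
  1 + q
    ∎
  where
  open ≤-Reasoning
  first : ∑ (upTo m) (𝟙 ∘ P?) ≤ 1
  first = ∑-𝟙≤1 P? (upTo⁺ m) λ i∈ j∈ Pi Pj →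
    ≡-mod⇒≡ (∈-upTo⁻ i∈) (∈-upTo⁻ j∈) (spaced _ _ Pi Pj)
  cancel : ∀ a b c → (a ℤ.+ b) ℤ.- (a ℤ.+ c) ≡ b ℤ.- c
  cancel = ℤ-Solver.solve-∀
  shifted : ∀ i j → _ → _ → m ∣ ∣ + i ℤ.- + j ∣
  shifted i j Pi Pj = subst (λ z → m ∣ ∣ z ∣)
    (trans (cong₂ ℤ._-_ (ℤ.pos-+ m i) (ℤ.pos-+ m j)) (cancel (+ m) (+ i) (+ j)))
    (spaced (m + i) (m + j) Pi Pj)

∣⇒≢0 : ∀ {m n} .{{_ : NonZero n}} → m ∣ n → m ≢ 0
∣⇒≢0 {n = n} 0∣n refl = ≢-nonZero⁻¹ n (0∣⇒≡0 0∣n)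

-- Two solutions of m ∣ e + a x differ by a multiple of m / gcd(a, m).
linear-congruence : ∀ {m} n .{{_ : NonZero n}} → m ∣ n → ∀ e a →
  m * ∑[ x ← allFin n ] 𝟙 (m ∣? ∣ e ℤ.+ a ℤ.* + toℕ x ∣) ≤ n * gcd ∣ a ∣ m
linear-congruence {m} n m∣n@(divides q n≡qm) e a
  with gcd ∣ a ∣ m in g≡ | gcd[m,n]∣n (∣ a ∣) m
... | g | divides m′ m≡m′g = begin
  m * ∑[ x ← allFin n ] 𝟙 (solution? (toℕ x)) ≡⟨ cong (m *_) (∑-allFin n (𝟙 ∘ solution?)) ⟩
  m * ∑ (upTo n) (𝟙 ∘ solution?)              ≡⟨ cong (λ k → m * ∑ (upTo k) (𝟙 ∘ solution?)) n≡[qg]m′ ⟩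
  m * ∑ (upTo (q * g * m′)) (𝟙 ∘ solution?)   ≤⟨ *-monoʳ-≤ m (∑-𝟙-spaced m′ (q * g) solution? spaced) ⟩
  m * (q * g)                                 ≡⟨ shuffle m q g ⟩
  q * m * g                                   ≡⟨ cong (_* g) n≡qm ⟨
  n * g                                       ∎
  where
  open ≤-Reasoning
  solution? : Decidable (λ x → m ∣ ∣ e ℤ.+ a ℤ.* + x ∣)
  solution? x = m ∣? ∣ e ℤ.+ a ℤ.* + x ∣
  shuffle : ∀ m q g → m * (q * g) ≡ q * m * g
  shuffle = solve-∀
  assoc : ∀ q m′ g → q * (m′ * g) ≡ q * g * m′
  assoc = solve-∀
  n≡[qg]m′ : n ≡ q * g * m′
  n≡[qg]m′ = trans n≡qm (trans (cong (q *_) m≡m′g) (assoc q m′ g))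
  instance
    g≢0 : NonZero g
    g≢0 = ≢-nonZero λ { refl → ∣⇒≢0 m∣n (trans m≡m′g (*-zeroʳ m′)) }
  difference : ∀ e a x y → (e ℤ.+ a ℤ.* x) ℤ.- (e ℤ.+ a ℤ.* y) ≡ a ℤ.* (x ℤ.- y)
  difference = ℤ-Solver.solve-∀
  spaced : ∀ i j → m ∣ ∣ e ℤ.+ a ℤ.* + i ∣ → m ∣ ∣ e ℤ.+ a ℤ.* + j ∣ → m′ ∣ ∣ + i ℤ.- + j ∣
  -- Since `m` divides both `D * ∣ a ∣` and `D * m`, it divides their gcd `D * g`; cancelling `g`
  -- leaves `m′ ∣ D`.
  spaced i j m∣i m∣j = *-cancelʳ-∣ g (subst₂ _∣_ m≡m′g Dg (gcd-greatest m∣Da (n∣m*n D)))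
    where
    D = ∣ + i ℤ.- + j ∣
    m∣Da : m ∣ D * ∣ a ∣
    m∣Da = subst (m ∣_)
      (trans (cong ∣_∣ (difference e a (+ i) (+ j))) (trans (ℤ.∣i*j∣≡∣i∣*∣j∣ a _) (*-comm (∣ a ∣) D)))
      (ℤ.∣⇒∣ᵤ (ℤ.∣m∣n⇒∣m-n (ℤ.∣ᵤ⇒∣ {+ m} {e ℤ.+ a ℤ.* + i} m∣i) (ℤ.∣ᵤ⇒∣ {+ m} {e ℤ.+ a ℤ.* + j} m∣j)))
    Dg : gcd (D * ∣ a ∣) (D * m) ≡ D * g
    Dg = trans (sym (c*gcd[m,n]≡gcd[cm,cn] D (∣ a ∣) m)) (cong (D *_) g≡)

-- The partial sum is carried in `e`, so that fixing the first coordinate leaves an expression of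
-- the same shape in the others.
affine : ∀ {n d} → ℤ → Vec ℤ d → Vec (Fin n) d → ℤ
affine e []       []      = e
affine e (a ∷ as) (x ∷ v) = affine (e ℤ.+ a ℤ.* + toℕ x) as v

-- The gcd of `n` and all coefficients: the h of the overview.
content : ∀ {d} → ℕ → Vec ℤ d → ℕ
content n []       = n
content n (a ∷ as) = gcd ∣ a ∣ (content n as)

content∣ : ∀ {d} n (as : Vec ℤ d) → content n as ∣ n
content∣ n []       = ∣-refl
content∣ n (a ∷ as) = ∣-trans (gcd[m,n]∣n (∣ a ∣) (content n as)) (content∣ n as)

-- Fix the first coordinate `x`. The others contribute only if the content `h` of the remaining
-- coefficients divides `e + a x`, which is a congruence modulo `h` in `x` alone. The indicator
-- stays in the bound because the induction step has to sum it over `x`.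
affine-congruence : ∀ {d} n .{{_ : NonZero n}} e (as : Vec ℤ d) →
  n * ∑[ x ← tuples (allFin n) d ] 𝟙 (n ∣? ∣ affine e as x ∣)
    ≤ n ^ d * (𝟙 (content n as ∣? ∣ e ∣) * content n as)
affine-congruence n e []
  rewrite +-identityʳ (𝟙 (n ∣? ∣ e ∣)) | +-identityʳ (𝟙 (n ∣? ∣ e ∣) * n)
  = ≤-reflexive (*-comm n _)
affine-congruence {suc d} n e (a ∷ as) = begin
  n * ∑[ v ← tuples (allFin n) (suc d) ] 𝟙 (n ∣? ∣ affine e (a ∷ as) v ∣)
    ≡⟨ cong (n *_) (∑-tuples-suc (allFin n) d _) ⟩
  n * ∑[ x ← allFin n ] ∑[ v ← tuples (allFin n) d ] 𝟙 (n ∣? ∣ affine (e′ x) as v ∣)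
    ≡⟨ ∑-*ˡ (allFin n) n _ ⟨
  ∑[ x ← allFin n ] (n * ∑[ v ← tuples (allFin n) d ] 𝟙 (n ∣? ∣ affine (e′ x) as v ∣))
    ≤⟨ ∑-mono (allFin n) (λ x → affine-congruence n (e′ x) as) ⟩
  ∑[ x ← allFin n ] (n ^ d * (𝟙 (h ∣? ∣ e′ x ∣) * h))
    ≡⟨ ∑-*ˡ (allFin n) (n ^ d) _ ⟩
  n ^ d * ∑[ x ← allFin n ] (𝟙 (h ∣? ∣ e′ x ∣) * h)
    ≡⟨ cong (n ^ d *_) (trans (∑-*ʳ (allFin n) _ h) (*-comm _ h)) ⟩
  n ^ d * (h * ∑[ x ← allFin n ] 𝟙 (h ∣? ∣ e′ x ∣))
    ≤⟨ *-monoʳ-≤ (n ^ d) one-coordinate ⟩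
  n ^ d * (n * (𝟙 (g ∣? ∣ e ∣) * g))
    ≡⟨ shuffle (n ^ d) n _ ⟩
  n ^ suc d * (𝟙 (g ∣? ∣ e ∣) * g)
    ∎
  where
  open ≤-Reasoning
  h = content n as
  g = gcd ∣ a ∣ h
  e′ : Fin n → ℤ
  e′ x = e ℤ.+ a ℤ.* + toℕ x
  shuffle : ∀ p n r → p * (n * r) ≡ n * p * r
  shuffle = solve-∀
  g∣e : ∀ x → h ∣ ∣ e′ x ∣ → g ∣ ∣ e ∣
  g∣e x h∣e′ = ℤ.∣⇒∣ᵤ (ℤ.∣m+n∣n⇒∣m {+ g} {e} (ℤ.∣ᵤ⇒∣ (∣-trans (gcd[m,n]∣n (∣ a ∣) h) h∣e′))
    (ℤ.∣m⇒∣m*n (+ toℕ x) (ℤ.∣ᵤ⇒∣ {+ g} {a} (gcd[m,n]∣m (∣ a ∣) h))))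
  one-coordinate : h * ∑[ x ← allFin n ] 𝟙 (h ∣? ∣ e′ x ∣) ≤ n * (𝟙 (g ∣? ∣ e ∣) * g)
  one-coordinate with g ∣? ∣ e ∣
  ... | yes _   = ≤-trans (linear-congruence n (content∣ n as) e a)
                          (≤-reflexive (cong (n *_) (sym (+-identityʳ g))))
  ... | no  g∤e = ≤-trans (≤-reflexive (trans (cong (h *_) no-solution) (*-zeroʳ h))) z≤n
    where
    no-solution : ∑[ x ← allFin n ] 𝟙 (h ∣? ∣ e′ x ∣) ≡ 0
    no-solution = trans (∑-cong (allFin n) λ x → 𝟙-no (h ∣? ∣ e′ x ∣) (g∤e ∘ g∣e x))
                        (trans (∑-const (allFin n) 0) (*-zeroʳ (length (allFin n))))

-- Points equidistant from two given points

-- ‖y - x‖ - ‖y′ - x‖ is affine in x; these are its constant term and its linear coefficients.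
constant : ∀ {n d} → Vec (Fin n) d → Vec (Fin n) d → ℤ
constant []       []         = + 0
constant {n} (y ∷ ys) (y′ ∷ ys′) =
  (+ toℕ y ℤ.- + toℕ y′) ℤ.* (+ toℕ y ℤ.+ + toℕ y′ ℤ.+ + 2 ℤ.* + n) ℤ.+ constant ys ys′

coefficients : ∀ {n d} → Vec (Fin n) d → Vec (Fin n) d → Vec ℤ d
coefficients = zipWith λ y y′ → + 2 ℤ.* (+ toℕ y′ ℤ.- + toℕ y)

squares : ∀ {n d} → Vec (Fin n) d → Vec (Fin n) d → ℕ
squares {n} x y = Vec.sum (zipWith (sqDiff n) x y)

+sqDiff : ∀ n (y x : Fin n) →
          + sqDiff n y x ≡ (+ toℕ y ℤ.+ + n ℤ.- + toℕ x) ℤ.* (+ toℕ y ℤ.+ + n ℤ.- + toℕ x)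
+sqDiff n y x = trans (ℤ.pos-* u u) (cong₂ ℤ._*_ u≡ u≡)
  where
  u = toℕ y + n ∸ toℕ x
  u≡ : + u ≡ + toℕ y ℤ.+ + n ℤ.- + toℕ x
  u≡ = sym (trans (ℤ.m-n≡m⊖n (toℕ y + n) (toℕ x))
                  (ℤ.⊖-≥ (≤-trans (<⇒≤ (toℕ<n x)) (m≤n+m n (toℕ y)))))

-- Coordinatewise a difference of two squares, in which the x² cancels; the summand `e` follows the
-- accumulator of `affine`.
affine-squares : ∀ {n d} e (y y′ x : Vec (Fin n) d) →
  affine (e ℤ.+ constant y y′) (coefficients y y′) x ≡ e ℤ.+ (+ squares y x ℤ.- + squares y′ x)
affine-squares e [] [] [] = refl
affine-squares {n} e (y ∷ ys) (y′ ∷ ys′) (x ∷ xs) = begin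
  affine (e ℤ.+ (b ℤ.+ c) ℤ.+ a ℤ.* + toℕ x) (coefficients ys ys′) xs
    ≡⟨ cong (λ z → affine z (coefficients ys ys′) xs) (regroup e b c (a ℤ.* + toℕ x)) ⟩
  affine (e ℤ.+ (b ℤ.+ a ℤ.* + toℕ x) ℤ.+ c) (coefficients ys ys′) xs
    ≡⟨ affine-squares (e ℤ.+ (b ℤ.+ a ℤ.* + toℕ x)) ys ys′ xs ⟩
  e ℤ.+ (b ℤ.+ a ℤ.* + toℕ x) ℤ.+ (+ S ℤ.- + S′)
    ≡⟨ cong (λ z → e ℤ.+ z ℤ.+ (+ S ℤ.- + S′)) (identity (+ toℕ y) (+ toℕ y′) (+ toℕ x) (+ n)) ⟩
  e ℤ.+ ((Y ℤ.* Y) ℤ.- (Y′ ℤ.* Y′)) ℤ.+ (+ S ℤ.- + S′)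
    ≡⟨ cong₂ (λ s t → e ℤ.+ (s ℤ.- t) ℤ.+ (+ S ℤ.- + S′)) (+sqDiff n y x) (+sqDiff n y′ x) ⟨
  e ℤ.+ (+ sqDiff n y x ℤ.- + sqDiff n y′ x) ℤ.+ (+ S ℤ.- + S′)
    ≡⟨ regroup′ e (+ sqDiff n y x) (+ sqDiff n y′ x) (+ S) (+ S′) ⟩
  e ℤ.+ (+ (sqDiff n y x + S) ℤ.- + (sqDiff n y′ x + S′))
    ∎
  where
  open ≡-Reasoning
  b = (+ toℕ y ℤ.- + toℕ y′) ℤ.* (+ toℕ y ℤ.+ + toℕ y′ ℤ.+ + 2 ℤ.* + n)
  c = constant ys ys′
  a = + 2 ℤ.* (+ toℕ y′ ℤ.- + toℕ y)
  S = squares ys xs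
  S′ = squares ys′ xs
  Y = + toℕ y ℤ.+ + n ℤ.- + toℕ x
  Y′ = + toℕ y′ ℤ.+ + n ℤ.- + toℕ x
  regroup : ∀ e b c d → e ℤ.+ (b ℤ.+ c) ℤ.+ d ≡ e ℤ.+ (b ℤ.+ d) ℤ.+ c
  regroup = ℤ-Solver.solve-∀
  regroup′ : ∀ e p q s t → e ℤ.+ (p ℤ.- q) ℤ.+ (s ℤ.- t) ≡ e ℤ.+ ((p ℤ.+ s) ℤ.- (q ℤ.+ t))
  regroup′ = ℤ-Solver.solve-∀
  identity : ∀ y y′ x n →
    (y ℤ.- y′) ℤ.* (y ℤ.+ y′ ℤ.+ + 2 ℤ.* n) ℤ.+ + 2 ℤ.* (y′ ℤ.- y) ℤ.* x
      ≡ (y ℤ.+ n ℤ.- x) ℤ.* (y ℤ.+ n ℤ.- x) ℤ.- (y′ ℤ.+ n ℤ.- x) ℤ.* (y′ ℤ.+ n ℤ.- x)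
  identity = ℤ-Solver.solve-∀

≡%⇒∣- : ∀ n .{{_ : NonZero n}} i j → i % n ≡ j % n → n ∣ ∣ + i ℤ.- + j ∣
≡%⇒∣- n i j i≡j = ℤ.∣⇒∣ᵤ (ℤ.divides (+ (i / n) ℤ.- + (j / n)) (begin
  + i ℤ.- + j
    ≡⟨ cong₂ ℤ._-_ (split i) (split j) ⟩
  (+ (i % n) ℤ.+ + (i / n) ℤ.* + n) ℤ.- (+ (j % n) ℤ.+ + (j / n) ℤ.* + n)
    ≡⟨ cong (λ r → (+ r ℤ.+ + (i / n) ℤ.* + n) ℤ.- (+ (j % n) ℤ.+ + (j / n) ℤ.* + n)) i≡j ⟩
  (+ (j % n) ℤ.+ + (i / n) ℤ.* + n) ℤ.- (+ (j % n) ℤ.+ + (j / n) ℤ.* + n)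
    ≡⟨ factor (+ (j % n)) (+ (i / n)) (+ (j / n)) (+ n) ⟩
  (+ (i / n) ℤ.- + (j / n)) ℤ.* + n ∎))
  where
  open ≡-Reasoning
  split : ∀ k → + k ≡ + (k % n) ℤ.+ + (k / n) ℤ.* + n
  split k = trans (cong +_ (m≡m%n+[m/n]*n k n))
                  (cong (λ z → + (k % n) ℤ.+ z) (ℤ.pos-* (k / n) n))
  factor : ∀ r p q n → (r ℤ.+ p ℤ.* n) ℤ.- (r ℤ.+ q ℤ.* n) ≡ (p ℤ.- q) ℤ.* n
  factor = ℤ-Solver.solve-∀

content-coefficients : ∀ {n d} → Vec (Fin n) d → Vec (Fin n) d → ℕ
content-coefficients {n} y y′ = content n (coefficients y y′)

equidistant-count : ∀ n .{{_ : NonZero n}} {d} (y y′ : Vec (Fin n) d) →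
  n * ∑[ x ← tuples (allFin n) d ] 𝟙 (dist n y x ≟ dist n y′ x) ≤ n ^ d * content-coefficients y y′
equidistant-count n {d} y y′ = begin
  n * ∑[ x ← tuples (allFin n) d ] 𝟙 (dist n y x ≟ dist n y′ x)
    ≤⟨ *-monoʳ-≤ n (∑-mono (tuples (allFin n) d) λ x → 𝟙-mono _ _ (equation x)) ⟩
  n * ∑[ x ← tuples (allFin n) d ] 𝟙 (n ∣? ∣ affine e (coefficients y y′) x ∣)
    ≤⟨ affine-congruence n e (coefficients y y′) ⟩
  n ^ d * (𝟙 (h ∣? ∣ e ∣) * h)
    ≤⟨ *-monoʳ-≤ (n ^ d) (*-monoˡ-≤ h (𝟙≤1 (h ∣? ∣ e ∣))) ⟩
  n ^ d * (1 * h)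
    ≡⟨ cong (n ^ d *_) (*-identityˡ h) ⟩
  n ^ d * h
    ∎
  where
  open ≤-Reasoning
  e = + 0 ℤ.+ constant y y′
  h = content-coefficients y y′
  equation : ∀ x → dist n y x ≡ dist n y′ x → n ∣ ∣ affine e (coefficients y y′) x ∣
  equation x eq = subst (λ z → n ∣ ∣ z ∣)
    (sym (trans (affine-squares (+ 0) y y′ x) (ℤ.+-identityˡ (+ squares y x ℤ.- + squares y′ x))))
    (≡%⇒∣- n (squares y x) (squares y′ x) eq)

-- The sum of the d-th powers of the contents

-- The indicator of y ≡ y′ (mod m), as a product over the coordinates.
agree : ∀ {n d} → ℕ → Vec (Fin n) d → Vec (Fin n) d → ℕ
agree m []       []         = 1
agree m (y ∷ ys) (y′ ∷ ys′) = 𝟙 (m ∣? ∣ ℤ.- + toℕ y ℤ.+ + 1 ℤ.* + toℕ y′ ∣) * agree m ys ys′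

-- The coordinates are independent, and each gives a linear congruence whose coefficient 1 has gcd 1
-- with `m`. The form `- y + 1 * y′` in `agree` is made for `linear-congruence`.
agree-count : ∀ {m} n .{{_ : NonZero n}} → m ∣ n → ∀ {d} (y : Vec (Fin n) d) →
              m ^ d * ∑[ y′ ← tuples (allFin n) d ] agree m y y′ ≤ n ^ d
agree-count n m∣n [] = ≤-refl
agree-count {m} n m∣n {suc d} (y ∷ ys) = begin
  m ^ suc d * ∑[ v ← tuples (allFin n) (suc d) ] agree m (y ∷ ys) v
    ≡⟨ cong (m ^ suc d *_) (∑-tuples-suc (allFin n) d _) ⟩
  m ^ suc d * ∑[ y′ ← allFin n ] ∑[ ys′ ← tuples (allFin n) d ] (𝟙 (near? y′) * agree m ys ys′)
    ≡⟨ cong (m ^ suc d *_) (trans (∑-cong (allFin n) λ y′ → ∑-*ˡ (tuples (allFin n) d) (𝟙 (near? y′)) _)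
                                  (∑-*ʳ (allFin n) (𝟙 ∘ near?) _)) ⟩
  m * m ^ d * (∑[ y′ ← allFin n ] 𝟙 (near? y′) * ∑[ ys′ ← tuples (allFin n) d ] agree m ys ys′)
    ≡⟨ interchange m (m ^ d) _ _ ⟩
  m * ∑[ y′ ← allFin n ] 𝟙 (near? y′) * (m ^ d * ∑[ ys′ ← tuples (allFin n) d ] agree m ys ys′)
    ≤⟨ *-mono-≤ (linear-congruence n m∣n (ℤ.- + toℕ y) (+ 1)) (agree-count n m∣n ys) ⟩
  n * gcd 1 m * n ^ d
    ≡⟨ cong (λ g → n * g * n ^ d) (gcd-zeroˡ m) ⟩
  n * 1 * n ^ d
    ≡⟨ cong (_* n ^ d) (*-identityʳ n) ⟩
  n ^ suc d
    ∎
  where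
  open ≤-Reasoning
  near? : ∀ y′ → Dec (m ∣ ∣ ℤ.- + toℕ y ℤ.+ + 1 ℤ.* + toℕ y′ ∣)
  near? y′ = m ∣? ∣ ℤ.- + toℕ y ℤ.+ + 1 ℤ.* + toℕ y′ ∣
  interchange : ∀ a b c d → a * b * (c * d) ≡ a * c * (b * d)
  interchange = solve-∀

odd⇒coprime-2 : ∀ {m} → ¬ (2 ∣ m) → Coprime m 2
odd⇒coprime-2 2∤m (i∣m , i∣2) with irreducible[2] i∣2
... | inj₁ i≡1  = i≡1
... | inj₂ refl = contradiction i∣m 2∤m

-- Oddness enters here: `m` divides every coefficient 2(y′ - y), and being coprime to 2 it divides
-- y′ - y.
agree-content : ∀ {n m} → ¬ (2 ∣ m) → ∀ {d} (y y′ : Vec (Fin n) d) →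
                m ∣ content-coefficients y y′ → agree m y y′ ≡ 1
agree-content 2∤m [] [] _ = refl
agree-content {n} {m} 2∤m (y ∷ ys) (y′ ∷ ys′) m∣h =
  cong₂ _*_ (𝟙-yes (m ∣? _) m∣y′-y)
            (agree-content 2∤m ys ys′ (∣-trans m∣h (gcd[m,n]∣n (∣ a ∣) h)))
  where
  a = + 2 ℤ.* (+ toℕ y′ ℤ.- + toℕ y)
  h = content-coefficients ys ys′
  reorder : ∀ y y′ → y′ ℤ.- y ≡ ℤ.- y ℤ.+ + 1 ℤ.* y′
  reorder = ℤ-Solver.solve-∀
  m∣y′-y : m ∣ ∣ ℤ.- + toℕ y ℤ.+ + 1 ℤ.* + toℕ y′ ∣
  m∣y′-y = subst (λ z → m ∣ ∣ z ∣) (reorder (+ toℕ y) (+ toℕ y′))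
    (coprime-divisor (odd⇒coprime-2 2∤m)
      (subst (m ∣_) (ℤ.∣i*j∣≡∣i∣*∣j∣ (+ 2) (+ toℕ y′ ℤ.- + toℕ y)) (∣-trans m∣h (gcd[m,n]∣m (∣ a ∣) h))))

-- The list counted by `τ`, so its length is `τ n` by definition.
divisors : ℕ → List ℕ
divisors n = filter (_∣? n) (map suc (upTo n))

∈-divisors : ∀ {m n} .{{_ : NonZero n}} → m ∣ n → m ∈ divisors n
∈-divisors {zero}  {n} 0∣n = contradiction (0∣⇒≡0 0∣n) (≢-nonZero⁻¹ n)
∈-divisors {suc m} {n} m∣n = ∈-filter⁺ (_∣? n) (∈-map⁺ suc (∈-upTo⁺ (∣⇒≤ m∣n))) m∣n

-- Charge each y′ to the divisor m of `n` equal to its content with `y`. Then y′ ≡ y (mod m), which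
-- leaves at most (n / m)^d choices of y′, so every divisor contributes at most n^d.
∑-content^d : ∀ n .{{_ : NonZero n}} → ¬ (2 ∣ n) → ∀ {d} (y : Vec (Fin n) d) →
              ∑[ y′ ← tuples (allFin n) d ] (content-coefficients y y′ ^ d) ≤ τ n * n ^ d
∑-content^d n 2∤n {d} y = begin
  ∑[ y′ ← tuples (allFin n) d ] (content-coefficients y y′ ^ d)
    ≤⟨ ∑-mono (tuples (allFin n) d) one-divisor ⟩
  ∑[ y′ ← tuples (allFin n) d ] ∑[ m ← divisors n ] (m ^ d * agree m y y′)
    ≡⟨ ∑-swap (tuples (allFin n) d) (divisors n) _ ⟩
  ∑[ m ← divisors n ] ∑[ y′ ← tuples (allFin n) d ] (m ^ d * agree m y y′)
    ≡⟨ ∑-cong (divisors n) (λ m → ∑-*ˡ (tuples (allFin n) d) (m ^ d) _) ⟩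
  ∑[ m ← divisors n ] (m ^ d * ∑[ y′ ← tuples (allFin n) d ] agree m y y′)
    ≤⟨ ∑-mono-∈ (divisors n) (λ m∈ → agree-count n (proj₂ (∈-filter⁻ (_∣? n) {xs = map suc (upTo n)} m∈)) y) ⟩
  ∑[ m ← divisors n ] (n ^ d)
    ≡⟨ ∑-const (divisors n) (n ^ d) ⟩
  τ n * n ^ d
    ∎
  where
  open ≤-Reasoning
  one-divisor : ∀ y′ → content-coefficients y y′ ^ d ≤ ∑[ m ← divisors n ] (m ^ d * agree m y y′)
  one-divisor y′ = begin
    h ^ d                   ≡⟨ *-identityʳ (h ^ d) ⟨
    h ^ d * 1               ≡⟨ cong (h ^ d *_) (agree-content (λ 2∣h → 2∤n (∣-trans 2∣h h∣n)) y y′ ∣-refl) ⟨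
    h ^ d * agree h y y′    ≤⟨ ∑-∈ (λ m → m ^ d * agree m y y′) (∈-divisors h∣n) ⟩
    ∑[ m ← divisors n ] (m ^ d * agree m y y′) ∎
    where
    h = content-coefficients y y′
    h∣n : h ∣ n
    h∣n = content∣ n (coefficients y y′)

-- Contents and the smallest prime divisor

prime-divisor : ∀ {m} → m ≢ 0 → m ≢ 1 → Σ ℕ λ p → Prime p × p ∣ m
prime-divisor {m} m≢0 m≢1 with factorise m {{≢-nonZero m≢0}}
... | record { factors = []; isFactorisation = m≡1 } = contradiction m≡1 m≢1
... | record { factors = p ∷ ps; isFactorisation = m≡ ; factorsPrime = p-prime ∷ _ } =
  p , p-prime , subst (p ∣_) (sym m≡) (m∣m*n (product ps))

-- A divisor `h` of `n` is either 1, where the first summand suffices, or has a prime factor and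
-- hence is at least `γ`, where the second does. This trades the linear weight `h` for the power
-- summed in `∑-content^d`.
^-weight-bound : ∀ {n} .{{_ : NonZero n}} γ → (∀ q → Prime q → q ∣ n → γ ≤ q) →
                 ∀ {h} → h ∣ n → ∀ d → γ ^ d * h ≤ γ ^ d + h ^ suc d
^-weight-bound {n} γ γ-least {h} h∣n d with h ≟ 1
... | yes refl = ≤-trans (≤-reflexive (*-identityʳ (γ ^ d))) (m≤m+n (γ ^ d) _)
... | no h≢1 with p , p-prime , p∣h ← prime-divisor (∣⇒≢0 h∣n) h≢1 = begin
  γ ^ d * h              ≤⟨ *-monoˡ-≤ h (^-monoˡ-≤ d (≤-trans (γ-least p p-prime (∣-trans p∣h h∣n)) p≤h)) ⟩
  h ^ d * h              ≡⟨ *-comm (h ^ d) h ⟩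
  h ^ suc d              ≤⟨ m≤n+m _ (γ ^ d) ⟩
  γ ^ d + h ^ suc d      ∎
  where
  open ≤-Reasoning
  p≤h : p ≤ h
  p≤h = ∣⇒≤ {{≢-nonZero (∣⇒≢0 h∣n)}} p∣h

-- The sum of the nonnegative terms `u x - l` can only grow from `xs` to `ys`; the terms with `l`
-- are moved across to avoid subtraction.
∑-excess : ∀ {xs ys : List A} l (u : A → ℕ) → Unique xs → (∀ {x} → x ∈ xs → x ∈ ys) →
           (∀ x → l ≤ u x) → ∑ xs u + length ys * l ≤ ∑ ys u + length xs * l
∑-excess {xs = xs} {ys} l u xs! xs⊆ys l≤u = begin
  ∑ xs u + length ys * l                            ≡⟨ cong (_+ length ys * l) (split xs) ⟩
  ∑ xs excess + length xs * l + length ys * l       ≤⟨ +-monoˡ-≤ _ (+-monoˡ-≤ _ (∑-⊆ excess xs! xs⊆ys)) ⟩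
  ∑ ys excess + length xs * l + length ys * l       ≡⟨ swap (∑ ys excess) (length xs * l) _ ⟩
  ∑ ys excess + length ys * l + length xs * l       ≡⟨ cong (_+ length xs * l) (split ys) ⟨
  ∑ ys u + length xs * l                            ∎
  where
  open ≤-Reasoning
  excess : _ → ℕ
  excess x = u x ∸ l
  split : ∀ zs → ∑ zs u ≡ ∑ zs excess + length zs * l
  split zs = trans (∑-cong zs λ x → sym (m∸n+n≡m (l≤u x)))
                   (trans (∑-+ zs excess (λ _ → l)) (cong₂ _+_ refl (∑-const zs l)))
  swap : ∀ a b c → a + b + c ≡ a + c + b
  swap = solve-∀

∑-*-∑ : ∀ (xs : List A) (ys : List B) f g →
        ∑ xs f * ∑ ys g ≡ ∑[ x ← xs ] ∑[ y ← ys ] (f x * g y)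
∑-*-∑ xs ys f g = sym (trans (∑-cong xs λ x → ∑-*ˡ ys (f x) g) (∑-*ʳ xs f (∑ ys g)))

∑-𝟙≟ : ∀ {n i} → i < n → ∑[ s ← upTo n ] 𝟙 (i ≟ s) ≡ 1
∑-𝟙≟ {n} {i} i<n = ≤-antisym
  (∑-𝟙≤1 (i ≟_) (upTo⁺ n) λ _ _ i≡s i≡t → trans (sym i≡s) i≡t)
  (≤-trans (≤-reflexive (sym (𝟙-yes (i ≟ i) refl))) (∑-∈ (λ s → 𝟙 (i ≟ s)) (∈-upTo⁺ i<n)))

-- Distance fibres and their energies

module _ {n : ℕ} .{{_ : NonZero n}} {d : ℕ} where

  points : List (Point n d)
  points = tuples (allFin n) d

  length-points : length points ≡ n ^ d
  length-points = trans (length-tuples (allFin n) d) (cong (_^ d) (length-tabulate {n = n} id))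

  fibre : List (Point n d) → Point n d → ℕ → List (Point n d)
  fibre S x s = filter (λ y → dist n y x ≟ s) S

  length-fibre : ∀ S x s → length (fibre S x s) ≡ ∑[ y ← S ] 𝟙 (dist n y x ≟ s)
  length-fibre S x s = length-filter≡∑ (λ y → dist n y x ≟ s) S

  ∑-length-fibre : ∀ S x → ∑[ s ← upTo n ] length (fibre S x s) ≡ length S
  ∑-length-fibre S x = begin
    ∑[ s ← upTo n ] length (fibre S x s)                   ≡⟨ ∑-cong (upTo n) (length-fibre S x) ⟩
    ∑[ s ← upTo n ] ∑[ y ← S ] 𝟙 (dist n y x ≟ s)         ≡⟨ ∑-swap (upTo n) S _ ⟩
    ∑[ y ← S ] ∑[ s ← upTo n ] 𝟙 (dist n y x ≟ s)         ≡⟨ ∑-cong S (λ y → ∑-𝟙≟ (m%n<n _ n)) ⟩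
    ∑[ y ← S ] 1                                            ≡⟨ length≡∑ S ⟨
    length S                                                ∎
    where open ≡-Reasoning

  energy₁ : List (Point n d) → Point n d → ℕ
  energy₁ S x = ∑[ s ← upTo n ] (length (fibre S x s) * length (fibre S x s))

  length²≤energy₁ : ∀ S x → length S * length S ≤ n * energy₁ S x
  length²≤energy₁ S x = begin
    length S * length S
      ≡⟨ cong₂ _*_ (∑-length-fibre S x) (∑-length-fibre S x) ⟨
    ∑[ s ← upTo n ] length (fibre S x s) * ∑[ s ← upTo n ] length (fibre S x s)
      ≤⟨ cauchy-schwarz (upTo n) _ (λ _ → 1) _ (λ s → ≤-reflexive (sym (*-identityˡ _))) ⟩
    ∑[ s ← upTo n ] 1 * energy₁ S x
      ≡⟨ cong (_* energy₁ S x) (trans (sym (length≡∑ (upTo n))) (length-upTo n)) ⟩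
    n * energy₁ S x
      ∎
    where open ≤-Reasoning

  -- Expanding the squares gives pairs (y, y′) lying in a common fibre; a pair shares at most one
  -- value `s`.
  energy₁≤equidistant : ∀ S x → energy₁ S x ≤ ∑[ y ← S ] ∑[ y′ ← S ] 𝟙 (dist n y x ≟ dist n y′ x)
  energy₁≤equidistant S x = begin
    energy₁ S x
      ≡⟨ ∑-cong (upTo n) (λ s → trans (cong₂ _*_ (length-fibre S x s) (length-fibre S x s))
                                      (∑-*-∑ S S _ _)) ⟩
    ∑[ s ← upTo n ] ∑[ y ← S ] ∑[ y′ ← S ] (𝟙 (dist n y x ≟ s) * 𝟙 (dist n y′ x ≟ s))
      ≡⟨ ∑-swap (upTo n) S _ ⟩
    ∑[ y ← S ] ∑[ s ← upTo n ] ∑[ y′ ← S ] (𝟙 (dist n y x ≟ s) * 𝟙 (dist n y′ x ≟ s))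
      ≡⟨ ∑-cong S (λ y → ∑-swap (upTo n) S _) ⟩
    ∑[ y ← S ] ∑[ y′ ← S ] ∑[ s ← upTo n ] (𝟙 (dist n y x ≟ s) * 𝟙 (dist n y′ x ≟ s))
      ≤⟨ ∑-mono S (λ y → ∑-mono S λ y′ → common (m%n<n _ n)) ⟩
    ∑[ y ← S ] ∑[ y′ ← S ] 𝟙 (dist n y x ≟ dist n y′ x)
      ∎
    where
    open ≤-Reasoning
    common : ∀ {i j} → i < n → ∑[ s ← upTo n ] (𝟙 (i ≟ s) * 𝟙 (j ≟ s)) ≤ 𝟙 (i ≟ j)
    common {i} {j} i<n with i ≟ j
    ... | yes refl = ≤-trans (∑-mono (upTo n) λ s → *-monoʳ-≤ (𝟙 (i ≟ s)) (𝟙≤1 (i ≟ s)))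
      (≤-reflexive (trans (∑-cong (upTo n) λ s → *-identityʳ (𝟙 (i ≟ s))) (∑-𝟙≟ i<n)))
    ... | no i≢j = ≤-reflexive (trans (∑-cong (upTo n) disjoint)
                                      (trans (∑-const (upTo n) 0) (*-zeroʳ (length (upTo n)))))
      where
      disjoint : ∀ s → 𝟙 (i ≟ s) * 𝟙 (j ≟ s) ≡ 0
      disjoint s with i ≟ s
      ... | yes refl = trans (+-identityʳ _) (𝟙-no (j ≟ i) (i≢j ∘ sym))
      ... | no _     = refl

  -- The number of pairs (y, y′) from `S` with equal distances to every point of the tuple.
  -- Splitting into fibres one point at a time prepares the inductions on the length of the tuple.
  energy : ∀ {j} → Vec (Point n d) j → List (Point n d) → ℕ
  energy []      S = length S * length S
  energy (x ∷ v) S = ∑[ s ← upTo n ] energy v (fibre S x s)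

-- Upper bounds for the energy summed over tuples from E

module EnergyBound
  {n : ℕ} .{{_ : NonZero n}} (n-odd : ¬ (2 ∣ n)) {d c : ℕ}
  (weight : ∀ {h} → h ∣ n → c * h ≤ c + h ^ d)
  where

  private
    X = points {n} {d}

  -- Count the points `x` for each pair (y, y′) first. The hypothesis `weight` turns c h into c +
  -- h^d, and the powers are then summed over all y′ in ℤ_n^d, not only those in `S`. The parameter
  -- `c` will be γ^(d-1).
  equidistant-pairs : ∀ {S : List (Point n d)} → Unique S →
    c * n * ∑[ x ← X ] ∑[ y ← S ] ∑[ y′ ← S ] 𝟙 (dist n y x ≟ dist n y′ x)
      ≤ n ^ d * (c * (length S * length S) + τ n * n ^ d * length S)
  equidistant-pairs {S} S! = begin
    c * n * ∑[ x ← X ] ∑[ y ← S ] ∑[ y′ ← S ] 𝟙 (dist n y x ≟ dist n y′ x)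
      ≡⟨ cong (c * n *_) (trans (∑-swap X S _) (∑-cong S λ y → ∑-swap X S _)) ⟩
    c * n * ∑[ y ← S ] ∑[ y′ ← S ] ∑[ x ← X ] 𝟙 (dist n y x ≟ dist n y′ x)
      ≡⟨ trans (sym (∑-*ˡ S (c * n) _)) (∑-cong S λ y → sym (∑-*ˡ S (c * n) _)) ⟩
    ∑[ y ← S ] ∑[ y′ ← S ] (c * n * ∑[ x ← X ] 𝟙 (dist n y x ≟ dist n y′ x))
      ≤⟨ ∑-mono S (λ y → ∑-mono S (pair y)) ⟩
    ∑[ y ← S ] ∑[ y′ ← S ] (n ^ d * (c + content-coefficients y y′ ^ d))
      ≡⟨ trans (∑-cong S λ y → ∑-*ˡ S (n ^ d) _) (∑-*ˡ S (n ^ d) _) ⟩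
    n ^ d * ∑[ y ← S ] ∑[ y′ ← S ] (c + content-coefficients y y′ ^ d)
      ≤⟨ *-monoʳ-≤ (n ^ d) (∑-mono S row) ⟩
    n ^ d * ∑[ y ← S ] (length S * c + τ n * n ^ d)
      ≡⟨ cong (n ^ d *_) (trans (∑-const S _) (regroup (length S) c (τ n * n ^ d))) ⟩
    n ^ d * (c * (length S * length S) + τ n * n ^ d * length S)
      ∎
    where
    open ≤-Reasoning
    regroup : ∀ e c t → e * (e * c + t) ≡ c * (e * e) + t * e
    regroup = solve-∀
    shuffle : ∀ c p h → c * (p * h) ≡ p * (c * h)
    shuffle = solve-∀
    pair : ∀ y y′ → c * n * ∑[ x ← X ] 𝟙 (dist n y x ≟ dist n y′ x)
                    ≤ n ^ d * (c + content-coefficients y y′ ^ d)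
    pair y y′ = begin
      c * n * ∑[ x ← X ] 𝟙 (dist n y x ≟ dist n y′ x)     ≡⟨ *-assoc c n _ ⟩
      c * (n * ∑[ x ← X ] 𝟙 (dist n y x ≟ dist n y′ x))   ≤⟨ *-monoʳ-≤ c (equidistant-count n y y′) ⟩
      c * (n ^ d * h)                                            ≡⟨ shuffle c (n ^ d) h ⟩
      n ^ d * (c * h)                                            ≤⟨ *-monoʳ-≤ (n ^ d) (weight h∣n) ⟩
      n ^ d * (c + h ^ d)                                        ∎
      where
      h = content-coefficients y y′
      h∣n : h ∣ n
      h∣n = content∣ n (coefficients y y′)
    row : ∀ y → ∑[ y′ ← S ] (c + content-coefficients y y′ ^ d) ≤ length S * c + τ n * n ^ d
    row y = begin
      ∑[ y′ ← S ] (c + content-coefficients y y′ ^ d)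
        ≡⟨ trans (∑-+ S (λ _ → c) _) (cong (_+ ∑[ y′ ← S ] (content-coefficients y y′ ^ d)) (∑-const S c)) ⟩
      length S * c + ∑[ y′ ← S ] (content-coefficients y y′ ^ d)
        ≤⟨ +-monoʳ-≤ (length S * c) (∑-⊆ _ S! λ _ → ∈-tuples-allFin _) ⟩
      length S * c + ∑[ y′ ← X ] (content-coefficients y y′ ^ d)
        ≤⟨ +-monoʳ-≤ (length S * c) (∑-content^d n n-odd y) ⟩
      length S * c + τ n * n ^ d
        ∎

  -- The terms n · energy₁ S x - |S|² are nonnegative by Cauchy–Schwarz, so their sum over E is at
  -- most their sum over all points.
  ∑-energy₁ : ∀ {E S : List (Point n d)} → Unique E → Unique S →
    c * n * ∑[ x ← E ] energy₁ S x
      ≤ c * length E * (length S * length S) + n ^ d * (τ n * n ^ d) * length S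
  ∑-energy₁ {E} {S} E! S! = +-cancelʳ-≤ (n ^ d * l) _ _ (begin
    c * n * ∑[ x ← E ] energy₁ S x + n ^ d * l
      ≡⟨ cong₂ (λ s t → s + t * l) (∑-*ˡ E (c * n) (energy₁ S)) (length-points {n} {d}) ⟨
    ∑[ x ← E ] (c * n * energy₁ S x) + length X * l
      ≤⟨ ∑-excess l _ E! (λ _ → ∈-tuples-allFin _) l≤ ⟩
    ∑[ x ← X ] (c * n * energy₁ S x) + length E * l
      ≡⟨ cong (_+ length E * l) (∑-*ˡ X (c * n) (energy₁ S)) ⟩
    c * n * ∑[ x ← X ] energy₁ S x + length E * l
      ≤⟨ +-monoˡ-≤ _ (*-monoʳ-≤ (c * n) (∑-mono X (energy₁≤equidistant S))) ⟩
    c * n * ∑[ x ← X ] ∑[ y ← S ] ∑[ y′ ← S ] 𝟙 (dist n y x ≟ dist n y′ x) + length E * l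
      ≤⟨ +-monoˡ-≤ _ (equidistant-pairs S!) ⟩
    n ^ d * (l + τ n * n ^ d * length S) + length E * l
      -- The main term over all points is exactly `n ^ d * l`, the amount to be cancelled; what
      -- remains is `length E * l` and the error.
      ≡⟨ regroup (n ^ d) c (length S * length S) (τ n * n ^ d) (length S) (length E) ⟩
    c * length E * (length S * length S) + n ^ d * (τ n * n ^ d) * length S + n ^ d * l
      ∎)
    where
    open ≤-Reasoning
    l = c * (length S * length S)
    regroup : ∀ p c q t s e → p * (c * q + t * s) + e * (c * q) ≡ c * e * q + p * t * s + p * (c * q)
    regroup = solve-∀
    l≤ : ∀ x → l ≤ c * n * energy₁ S x
    l≤ x = ≤-trans (*-monoʳ-≤ c (length²≤energy₁ S x)) (≤-reflexive (sym (*-assoc c n _)))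

  module _ {E : List (Point n d)} (E! : Unique E) where

    private
      e = length E
      b = n ^ d * (τ n * n ^ d)

    -- The coefficient of the error term, which is linear in |S|. In the recurrence the first
    -- summand is the error of `∑-energy₁`, the second the errors inherited from the fibres around
    -- each of the `e` points.
    loss : ℕ → ℕ
    loss zero    = 0
    loss (suc j) = e ^ j * b + n * e * loss j

    -- `S` varies in the induction: the first point `x` replaces it by its fibres, whose lengths sum
    -- to |S| and whose squared lengths sum to `energy₁ S x`.
    ∑-energy : ∀ j {S} → Unique S →
      c * n ^ j * ∑[ v ← tuples E j ] energy v S ≤ c * e ^ j * (length S * length S) + loss j * length S
    ∑-energy zero {S} S! = ≤-reflexive (identity c (length S * length S))
      where
      identity : ∀ c q → c * 1 * (q + 0) ≡ c * 1 * q + 0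
      identity = solve-∀
    ∑-energy (suc j) {S} S! = begin
      c * n ^ suc j * ∑[ v ← tuples E (suc j) ] energy v S
        ≡⟨ cong (c * n ^ suc j *_) (trans (∑-tuples-suc E j _) (∑-cong E λ x → ∑-swap (tuples E j) (upTo n) _)) ⟩
      c * n ^ suc j * ∑[ x ← E ] ∑[ s ← upTo n ] ∑[ v ← tuples E j ] energy v (fibre S x s)
        ≡⟨ cong (_* ∑[ x ← E ] ∑[ s ← upTo n ] ∑[ v ← tuples E j ] energy v (fibre S x s)) (commute c n (n ^ j)) ⟩
      n * (c * n ^ j) * ∑[ x ← E ] ∑[ s ← upTo n ] ∑[ v ← tuples E j ] energy v (fibre S x s)
        ≡⟨ trans (*-assoc n (c * n ^ j) _) (cong (n *_)
             (trans (sym (∑-*ˡ E (c * n ^ j) _)) (∑-cong E λ x → sym (∑-*ˡ (upTo n) (c * n ^ j) _)))) ⟩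
      n * ∑[ x ← E ] ∑[ s ← upTo n ] (c * n ^ j * ∑[ v ← tuples E j ] energy v (fibre S x s))
        ≤⟨ *-monoʳ-≤ n (∑-mono E λ x → ∑-mono (upTo n) λ s → ∑-energy j (filter⁺ _ S!)) ⟩
      n * ∑[ x ← E ] ∑[ s ← upTo n ] (c * e ^ j * (length (fibre S x s) * length (fibre S x s))
                                         + loss j * length (fibre S x s))
        ≡⟨ cong (n *_) (∑-cong E sum-fibres) ⟩
      n * ∑[ x ← E ] (c * e ^ j * energy₁ S x + loss j * length S)
        ≡⟨ cong (n *_) (trans (∑-+ E _ _) (cong₂ _+_ (∑-*ˡ E (c * e ^ j) _) (∑-const E _))) ⟩
      n * (c * e ^ j * ∑[ x ← E ] energy₁ S x + e * (loss j * length S))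
        ≡⟨ regroup n c (e ^ j) (∑ E (energy₁ S)) e (loss j) (length S) ⟩
      e ^ j * (c * n * ∑[ x ← E ] energy₁ S x) + n * e * loss j * length S
        ≤⟨ +-monoˡ-≤ _ (*-monoʳ-≤ (e ^ j) (∑-energy₁ E! S!)) ⟩
      e ^ j * (c * e * (length S * length S) + b * length S) + n * e * loss j * length S
        ≡⟨ regroup′ (e ^ j) c e (length S * length S) b (length S) (n * e * loss j) ⟩
      c * e ^ suc j * (length S * length S) + loss (suc j) * length S
        ∎
      where
      open ≤-Reasoning
      commute : ∀ c n p → c * (n * p) ≡ n * (c * p)
      commute = solve-∀
      regroup : ∀ n c p q e l s → n * (c * p * q + e * (l * s)) ≡ p * (c * n * q) + n * e * l * s
      regroup = solve-∀
      regroup′ : ∀ p c e q b s r → p * (c * e * q + b * s) + r * s ≡ c * (e * p) * q + (p * b + r) * s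
      regroup′ = solve-∀
      sum-fibres : ∀ x → ∑[ s ← upTo n ] (c * e ^ j * (length (fibre S x s) * length (fibre S x s))
                                            + loss j * length (fibre S x s))
                         ≡ c * e ^ j * energy₁ S x + loss j * length S
      sum-fibres x = trans (∑-+ (upTo n) _ _) (cong₂ _+_ (∑-*ˡ (upTo n) (c * e ^ j) _)
        (trans (∑-*ˡ (upTo n) (loss j) _) (cong (loss j *_) (∑-length-fibre S x))))

    -- Unrolled, `loss (suc j)` is the sum of b n^i e^j over i ≤ j, and the term with i = j is the
    -- largest.
    loss-bound : .{{_ : NonZero e}} → ∀ j → loss (suc j) ≤ suc j * (b * n ^ j * e ^ j)
    loss-bound zero    = ≤-reflexive (identity b (n * e))
      where
      identity : ∀ b x → 1 * b + x * 0 ≡ 1 * (b * 1 * 1)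
      identity = solve-∀
    loss-bound (suc j) = begin
      e ^ suc j * b + n * e * loss (suc j)
        ≤⟨ +-mono-≤ (m≤m*n _ (n ^ suc j) {{m^n≢0 n (suc j)}}) (*-monoʳ-≤ (n * e) (loss-bound j)) ⟩
      e ^ suc j * b * n ^ suc j + n * e * (suc j * (b * n ^ j * e ^ j))
        ≡⟨ regroup e n (e ^ j) (n ^ j) b (suc j) ⟩
      suc (suc j) * (b * n ^ suc j * e ^ suc j)
        ∎
      where
      open ≤-Reasoning
      regroup : ∀ e n p q b i → e * p * b * (n * q) + n * e * (i * (b * q * p))
                                ≡ (1 + i) * (b * (n * q) * (e * p))
      regroup = solve-∀

    -- For `S = E` the size hypothesis makes the loss at most `suc j` times the main term, whence
    -- the factor `suc (suc j)`.
    ∑-energy-E : .{{_ : NonZero c}} .{{_ : NonZero e}} → ∀ {k} → b * n ^ k ≤ e * e * c → ∀ {j} → j ≤ k →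
      n ^ suc j * ∑[ v ← tuples E (suc j) ] energy v E ≤ suc (suc j) * (e ^ suc j * (e * e))
    ∑-energy-E {k} large {j} j≤k = *-cancelˡ-≤ c (begin
      c * (n ^ suc j * Q)
        ≡⟨ *-assoc c _ Q ⟨
      c * n ^ suc j * Q
        ≤⟨ ∑-energy (suc j) E! ⟩
      c * e ^ suc j * (e * e) + loss (suc j) * e
        ≤⟨ +-monoʳ-≤ (c * e ^ suc j * (e * e)) (*-monoˡ-≤ e (loss-bound j)) ⟩
      c * e ^ suc j * (e * e) + suc j * (b * n ^ j * e ^ j) * e
        ≤⟨ +-monoʳ-≤ (c * e ^ suc j * (e * e)) (*-monoˡ-≤ e (*-monoʳ-≤ (suc j) (*-monoˡ-≤ (e ^ j) large-j))) ⟩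
      c * e ^ suc j * (e * e) + suc j * (e * e * c * e ^ j) * e
        ≡⟨ regroup c e (e ^ j) (suc j) ⟩
      c * (suc (suc j) * (e ^ suc j * (e * e)))
        ∎)
      where
      open ≤-Reasoning
      Q = ∑[ v ← tuples E (suc j) ] energy v E
      large-j : b * n ^ j ≤ e * e * c
      large-j = ≤-trans (*-monoʳ-≤ b (^-monoʳ-≤ n j≤k)) large
      regroup : ∀ c e p i → c * (e * p) * (e * e) + i * (e * e * c * p) * e
                            ≡ c * ((1 + i) * (e * p * (e * e)))
      regroup = solve-∀

-- From a second moment to many large values

unless : ∀ {P : Set} → Dec P → ℕ → ℕ
unless (yes _) x = 0
unless (no _)  x = x

-- By Cauchy–Schwarz, the x with r x small carry at most half of the total of a.
large-on-many : ∀ (xs : List A) (a r q : A → ℕ) {e m M D} .{{_ : NonZero e}} .{{_ : NonZero D}} →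
  (∀ x → a x ≤ e) → (∀ x → a x * a x ≤ r x * q x) →
  length xs * e ≤ M * ∑ xs a → m * ∑ xs q ≤ D * (length xs * (e * e)) →
  length xs ≤ 2 * M * ∑[ x ← xs ] 𝟙 (m ≤? 4 * M * M * D * r x)
large-on-many xs a r q {e} {m} {M} {D} a≤e a²≤rq te≤Ma mq≤Dte² =
  -- The density hypothesis is used twice, so that one copy of `t * e` can pay for the bad part.
  *-cancelʳ-≤ _ _ e (+-cancelʳ-≤ (t * e) _ _ (begin
    t * e + t * e                       ≤⟨ +-mono-≤ te≤Ma te≤Ma ⟩
    M * ∑ xs a + M * ∑ xs a             ≡⟨ double M (∑ xs a) ⟩
    2 * M * ∑ xs a                      ≤⟨ *-monoʳ-≤ (2 * M) split ⟩
    2 * M * (e * G + Bad)               ≡⟨ distribute (2 * M) e G Bad ⟩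
    2 * M * G * e + 2 * M * Bad         ≤⟨ +-monoʳ-≤ (2 * M * G * e) bad-small ⟩
    2 * M * G * e + t * e               ∎))
  where
  open ≤-Reasoning
  t = length xs
  -- Chosen so that `D * (2 * M * Bad)²` equals `K * Bad²` in `bad-small`.
  K = 4 * M * M * D
  good? : ∀ x → Dec (m ≤ K * r x)
  good? x = m ≤? K * r x
  G = ∑[ x ← xs ] 𝟙 (good? x)
  Bad = ∑[ x ← xs ] unless (good? x) (a x)
  R = ∑[ x ← xs ] unless (good? x) (r x)
  double : ∀ m a → m * a + m * a ≡ 2 * m * a
  double = solve-∀
  distribute : ∀ m e g b → m * (e * g + b) ≡ m * g * e + m * b
  distribute = solve-∀
  split-at : ∀ x → a x ≤ e * 𝟙 (good? x) + unless (good? x) (a x)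
  split-at x with good? x
  ... | yes _ = ≤-trans (a≤e x) (≤-reflexive (sym (trans (+-identityʳ _) (*-identityʳ e))))
  ... | no _  = m≤n+m (a x) (e * 0)
  split : ∑ xs a ≤ e * G + Bad
  split = ≤-trans (∑-mono xs split-at)
    (≤-reflexive (trans (∑-+ xs _ _) (cong (_+ Bad) (∑-*ˡ xs e (λ x → 𝟙 (good? x))))))
  Bad²≤RQ : Bad * Bad ≤ R * ∑ xs q
  Bad²≤RQ = cauchy-schwarz xs _ _ q pointwise
    where
    pointwise : ∀ x → unless (good? x) (a x) * unless (good? x) (a x) ≤ unless (good? x) (r x) * q x
    pointwise x with good? x
    ... | yes _ = z≤n
    ... | no _  = a²≤rq x
  CR≤tm : K * R ≤ t * m
  CR≤tm = begin
    K * R                                        ≡⟨ ∑-*ˡ xs K _ ⟨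
    ∑[ x ← xs ] (K * unless (good? x) (r x))   ≤⟨ ∑-mono xs pointwise ⟩
    ∑[ x ← xs ] m                               ≡⟨ ∑-const xs m ⟩
    t * m                                        ∎
    where
    pointwise : ∀ x → K * unless (good? x) (r x) ≤ m
    pointwise x with good? x
    ... | yes _     = ≤-trans (≤-reflexive (*-zeroʳ K)) z≤n
    ... | no m≰Crx  = ≰⇒≥ m≰Crx
  square : ∀ d m b → d * (2 * m * b * (2 * m * b)) ≡ 4 * m * m * d * (b * b)
  square = solve-∀
  regroup : ∀ t d e → t * (d * (t * (e * e))) ≡ d * (t * e * (t * e))
  regroup = solve-∀
  bad-small : 2 * M * Bad ≤ t * e
  bad-small = square-cancel-≤ _ _ (*-cancelˡ-≤ D (begin
    D * (2 * M * Bad * (2 * M * Bad))   ≡⟨ square D M Bad ⟩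
    K * (Bad * Bad)                     ≤⟨ *-monoʳ-≤ K Bad²≤RQ ⟩
    K * (R * ∑ xs q)                    ≡⟨ *-assoc K R _ ⟨
    K * R * ∑ xs q                      ≤⟨ *-monoˡ-≤ (∑ xs q) CR≤tm ⟩
    t * m * ∑ xs q                      ≡⟨ *-assoc t m _ ⟩
    t * (m * ∑ xs q)                    ≤⟨ *-monoʳ-≤ t mq≤Dte² ⟩
    t * (D * (t * (e * e)))             ≡⟨ regroup t D e ⟩
    D * (t * e * (t * e))               ∎))

-- Distance vectors and extension of simplex types

0<∑-𝟙⇒∃ : ∀ {P : Pred A _} (P? : Decidable P) xs → 0 < ∑ xs (𝟙 ∘ P?) → Σ A λ x → x ∈ xs × P x
0<∑-𝟙⇒∃ P? (x ∷ xs) 0<∑ with P? x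
... | yes px = x , here refl , px
... | no _ with y , y∈xs , py ← 0<∑-𝟙⇒∃ P? xs 0<∑ = y , there y∈xs , py

lookup-≢ : ∀ {k} (s t : Vec ℕ k) → s ≢ t → Σ (Fin k) λ i → lookup s i ≢ lookup t i
lookup-≢ []      []      s≢t = contradiction refl s≢t
lookup-≢ (x ∷ s) (y ∷ t) s≢t with x ≟ y
... | no x≢y   = zero , x≢y
... | yes refl with i , p ← lookup-≢ s t (s≢t ∘ cong (x ∷_)) = suc i , p

length-concatMap : ∀ (f : A → List B) xs → length (concatMap f xs) ≡ ∑[ x ← xs ] length (f x)
length-concatMap f []       = refl
length-concatMap f (x ∷ xs) = trans (length-++ (f x)) (cong₂ _+_ refl (length-concatMap f xs))

-- The type obtained from t by adding a vertex, numbered 0, at distances s from the old ones.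
extend : ∀ {k} → Vec ℕ (suc k) → SimplexType k → SimplexType (suc k)
extend s t zero    (suc j) _         = lookup s j
extend s t (suc i) (suc j) (s≤s i<j) = t i j i<j

-- The new vertex brings `suc j` distances, in agreement with Pascal's rule for the exponent.
size-step : ∀ n j p K {l l′} → n ^ (suc j C 2) ≤ p * l → n ^ suc j * l ≤ K * l′ →
            n ^ (suc (suc j) C 2) ≤ K * p * l′
size-step n j p K {l} {l′} size size′ = begin
  n ^ (suc (suc j) C 2)          ≡⟨ cong (n ^_) pascal ⟩
  n ^ (suc j + suc j C 2)        ≡⟨ ^-distribˡ-+-* n (suc j) (suc j C 2) ⟩
  n ^ suc j * n ^ (suc j C 2)    ≤⟨ *-monoʳ-≤ (n ^ suc j) size ⟩
  n ^ suc j * (p * l)            ≡⟨ shuffle (n ^ suc j) p l ⟩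
  p * (n ^ suc j * l)            ≤⟨ *-monoʳ-≤ p size′ ⟩
  p * (K * l′)                   ≡⟨ shuffle′ p K l′ ⟩
  K * p * l′                     ∎
  where
  open ≤-Reasoning
  pascal : suc (suc j) C 2 ≡ suc j + suc j C 2
  pascal = trans (sym (nCk+nC[k+1]≡[n+1]C[k+1] (suc j) 1)) (cong (_+ suc j C 2) (nC1≡n (suc j)))
  shuffle : ∀ m p l → m * (p * l) ≡ p * (m * l)
  shuffle = solve-∀
  shuffle′ : ∀ p c l → p * (c * l) ≡ c * p * l
  shuffle′ = solve-∀

-- The constants of `many-types` multiplied together: each step halves the density, so `M` doubles.
proportion : ℕ → ℕ → ℕ
proportion M zero    = 1
proportion M (suc j) = 4 * M * M * suc (suc j) * proportion (2 * M) j

module _ {n : ℕ} .{{_ : NonZero n}} {d : ℕ} where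

  -- The distinct vectors of distances from points of `S` to the tuple. The recursion through fibres
  -- is that of `energy`, which lets the two be compared level by level.
  distances : ∀ {j} → Vec (Point n d) j → List (Point n d) → List (Vec ℕ j)
  distances []      []      = []
  distances []      (_ ∷ _) = [] ∷ []
  distances (x ∷ v) S       = concatMap (λ s → map (s ∷_) (distances v (fibre S x s))) (upTo n)

  ∈-distances⁻ : ∀ {j} (v : Vec (Point n d) j) S {s} → s ∈ distances v S →
                 Σ (Point n d) λ y → y ∈ S × s ≡ Vec.map (dist n y) v
  ∈-distances⁻ []      (y ∷ S) (here refl) = y , here refl , refl
  ∈-distances⁻ (x ∷ v) S       s∈
    with s₀ , _ , s∈map ← find (∈-concatMap⁻ (λ s → map (s ∷_) (distances v (fibre S x s))) {xs = upTo n} s∈)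
    with s′ , s′∈ , refl ← ∈-map⁻ (s₀ ∷_) s∈map
    with y , y∈fibre , refl ← ∈-distances⁻ v (fibre S x s₀) s′∈
    with y∈S , refl ← ∈-filter⁻ (λ y → dist n y x ≟ s₀) {xs = S} y∈fibre
    = y , y∈S , refl

  distances! : ∀ {j} (v : Vec (Point n d) j) S → Unique (distances v S)
  distances! []      []      = []
  distances! []      (_ ∷ _) = [] ∷ []
  distances! (x ∷ v) S       = concat⁺
    (All.map⁺ (All.universal (λ s → map⁺ ∷-injectiveʳ (distances! v (fibre S x s))) (upTo n)))
    (AllPairs.map⁺ (AllPairs.map disjoint (upTo⁺ n)))
    where
    disjoint : ∀ {s t} → s ≢ t → ∀ {u} →
      ¬ (u ∈ map (s ∷_) (distances v (fibre S x s)) × u ∈ map (t ∷_) (distances v (fibre S x t)))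
    disjoint s≢t (u∈ , u∈′) with _ , _ , refl ← ∈-map⁻ _ u∈ with _ , _ , eq ← ∈-map⁻ _ u∈′ =
      s≢t (∷-injectiveˡ eq)

  -- Cauchy-Schwarz over the classes of points of `S` with equal distance vectors, carried out one
  -- fibre level at a time; this is where the slack in `cauchy-schwarz` is needed.
  length²≤distances*energy : ∀ {j} (v : Vec (Point n d) j) S →
                             length S * length S ≤ length (distances v S) * energy v S
  length²≤distances*energy []      []      = z≤n
  length²≤distances*energy []      (_ ∷ _) = ≤-reflexive (sym (+-identityʳ _))
  length²≤distances*energy (x ∷ v) S       = begin
    length S * length S
      ≡⟨ cong₂ _*_ (∑-length-fibre S x) (∑-length-fibre S x) ⟨
    ∑[ s ← upTo n ] length (fibre S x s) * ∑[ s ← upTo n ] length (fibre S x s)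
      ≤⟨ cauchy-schwarz (upTo n) _ _ _ (λ s → length²≤distances*energy v (fibre S x s)) ⟩
    ∑[ s ← upTo n ] length (distances v (fibre S x s)) * energy (x ∷ v) S
      ≡⟨ cong (_* energy (x ∷ v) S) (trans (length-concatMap _ (upTo n))
           (∑-cong (upTo n) λ s → length-map (s ∷_) (distances v (fibre S x s)))) ⟨
    length (distances (x ∷ v) S) * energy (x ∷ v) S
      ∎
    where open ≤-Reasoning

  energy-mono : ∀ {j} (v : Vec (Point n d) j) {S T} → S ⊆ T → energy v S ≤ energy v T
  energy-mono []      S⊆T = *-mono-≤ (length-mono-≤ S⊆T) (length-mono-≤ S⊆T)
  energy-mono (x ∷ v) S⊆T = ∑-mono (upTo n) λ s →
    energy-mono v (⊆-filter⁺ _ _ (λ { refl → id }) S⊆T)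

  -- The predicate `P` lets the induction ask for vertices that still admit many further ones.
  record Realised (E : List (Point n d)) {k} (P : Pred (Vec (Point n d) (suc k)) 0ℓ) (t : SimplexType k) : Set where
    constructor realise
    field
      vertices  : Vec (Point n d) (suc k)
      satisfies : P vertices
      inside    : ∀ i → lookup vertices i ∈ E
      distanced : ∀ i j (i<j : i Fin.< j) → t i j i<j ≡ dist n (lookup vertices i) (lookup vertices j)

  module _ (E : List (Point n d)) where

    slice : ∀ {k} {P : Pred (Vec (Point n d) (suc k)) 0ℓ} → Decidable P → Vec (Point n d) k → List (Point n d)
    slice P? v = filter (λ y → P? (y ∷ v)) E

    extend-realised : ∀ {k} {P : Pred (Vec (Point n d) (suc (suc k))) 0ℓ} (P? : Decidable P) {t : SimplexType k} {s} →
      ∀ v → (∀ i → lookup v i ∈ E) → (∀ i j i<j → t i j i<j ≡ dist n (lookup v i) (lookup v j)) →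
      s ∈ distances v (slice P? v) → Realised E P (extend s t)
    extend-realised P? v v∈E t≡ s∈
      with y , y∈slice , refl ← ∈-distances⁻ v (slice P? v) s∈
      with y∈E , Pyv ← ∈-filter⁻ (λ y → P? (y ∷ v)) {xs = E} y∈slice
      = realise (y ∷ v) Pyv (λ { zero → y∈E ; (suc i) → v∈E i })
          λ { zero (suc j) _ → lookup-map j (dist n y) v
            ; (suc i) (suc j) (s≤s i<j) → t≡ i j i<j }

    extend-different : ∀ {k} {t u : SimplexType k} s s′ → DifferentTypes t u →
                       DifferentTypes (extend s t) (extend s′ u)
    extend-different s s′ (i , j , i<j , t≢u) = suc i , suc j , s≤s i<j , t≢u

    extend-injective : ∀ {k} (t : SimplexType k) {s s′} → s ≢ s′ →
                       DifferentTypes (extend s t) (extend s′ t)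
    extend-injective t s≢s′ with i , p ← lookup-≢ _ _ s≢s′ = zero , suc i , s≤s z≤n , p

    -- To the chosen vertices of each type, attach every distance vector coming from their slice.
    -- Extensions of one type differ in the new distances, extensions of different types already in
    -- the old ones; the last component carries the latter fact through the induction.
    extend-all : ∀ {k m K} {P : Pred (Vec (Point n d) (suc (suc k))) 0ℓ} (P? : Decidable P)
      {L : List (SimplexType k)} → AllPairs DifferentTypes L →
      All (Realised E (λ v → m ≤ K * length (distances v (slice P? v)))) L →
      Σ (List (SimplexType (suc k))) λ L′ →
        AllPairs DifferentTypes L′ × All (Realised E P) L′ × m * length L ≤ K * length L′ ×
        (∀ {u} → All (DifferentTypes u) L → ∀ s → All (DifferentTypes (extend s u)) L′)
    extend-all {m = m} P? [] [] = [] , [] , [] , ≤-trans (≤-reflexive (*-zeroʳ m)) z≤n , λ _ _ → []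
    extend-all {m = m} {K} P? {t ∷ L} (t∉L ∷ L!) (realise v m≤ v∈E t≡ ∷ real)
      with L′ , L′! , real′ , size , apart ← extend-all {m = m} {K} P? L! real
      = map (λ s → extend s t) D ++ L′
      , AllPairs.++⁺ (AllPairs.map⁺ (AllPairs.map (extend-injective t) (distances! v _))) L′!
                     (All.map⁺ (All.universal (apart t∉L) D))
      , All.++⁺ (All.map⁺ (All.tabulate (extend-realised P? v v∈E t≡))) real′
      , size′
      , λ { {u} (u≢t ∷ u∉L) s → All.++⁺ (All.map⁺ (All.universal (λ s′ → extend-different s s′ u≢t) D))
                                        (apart u∉L s) }
      where
      D = distances v (slice P? v)
      open ≤-Reasoning
      size′ : m * suc (length L) ≤ K * length (map (λ s → extend s t) D ++ L′)
      size′ = begin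
        m * suc (length L)                               ≡⟨ *-suc m (length L) ⟩
        m + m * length L                                 ≤⟨ +-mono-≤ m≤ size ⟩
        K * length D + K * length L′                     ≡⟨ *-distribˡ-+ K (length D) _ ⟨
        K * (length D + length L′)                       ≡⟨ cong (λ l → K * (l + length L′)) (length-map _ D) ⟨
        K * (length (map (λ s → extend s t) D) + length L′) ≡⟨ cong (K *_) (length-++ (map (λ s → extend s t) D)) ⟨
        K * length (map (λ s → extend s t) D ++ L′)      ∎

    -- Induction on the number of vertices

    private e = length E

    -- The constant is that of `large-on-many` with `D = suc (suc j)`, the factor in the energy
    -- bound.
    rich? : ∀ {j} M {P : Pred (Vec (Point n d) (suc (suc j))) 0ℓ} (P? : Decidable P) →
            Decidable (λ v → n ^ suc j ≤ 4 * M * M * suc (suc j) * length (distances v (slice P? v)))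
    rich? {j} M P? v = n ^ suc j ≤? 4 * M * M * suc (suc j) * length (distances v (slice P? v))

    -- `large-on-many` with slice sizes for `a`, numbers of distance vectors for `r` and energies of
    -- `E` for `q`; a slice has at most the energy of `E`.
    many-rich : .{{_ : NonZero e}} → ∀ j →
      n ^ suc j * ∑[ v ← tuples E (suc j) ] energy v E ≤ suc (suc j) * (e ^ suc j * (e * e)) →
      ∀ M {P : Pred (Vec (Point n d) (suc (suc j))) 0ℓ} (P? : Decidable P) →
      e ^ suc (suc j) ≤ M * ∑ (tuples E (suc (suc j))) (𝟙 ∘ P?) →
      e ^ suc j ≤ 2 * M * ∑ (tuples E (suc j)) (𝟙 ∘ rich? M P?)
    many-rich j energy≤ M P? dense = subst (_≤ 2 * M * ∑ T (𝟙 ∘ rich? M P?)) (length-tuples E (suc j))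
      (large-on-many T (λ v → length (slice P? v)) (λ v → length (distances v (slice P? v))) (λ v → energy v E)
        {m = n ^ suc j} {M} {suc (suc j)}
        (λ v → length-mono-≤ (slice⊆E v))
        (λ v → ≤-trans (length²≤distances*energy v (slice P? v))
                       (*-monoʳ-≤ (length (distances v (slice P? v))) (energy-mono v (slice⊆E v))))
        (subst₂ _≤_ (trans (*-comm e _) (cong (_* e) (sym (length-tuples E (suc j))))) (cong (M *_) slices) dense)
        (subst (λ l → n ^ suc j * ∑[ v ← T ] energy v E ≤ suc (suc j) * (l * (e * e)))
               (sym (length-tuples E (suc j))) energy≤))
      where
      T = tuples E (suc j)
      slice⊆E : ∀ v → slice P? v ⊆ E
      slice⊆E v = filter-⊆ (λ y → P? (y ∷ v)) E
      slices : ∑ (tuples E (suc (suc j))) (𝟙 ∘ P?) ≡ ∑[ v ← T ] length (slice P? v)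
      slices = trans (∑-tuples-suc E (suc j) _) (trans (∑-swap E T _)
                 (∑-cong T λ v → sym (length-filter≡∑ (λ y → P? (y ∷ v)) E)))

    some-vertex : .{{_ : NonZero e}} → ∀ M {P : Pred (Vec (Point n d) 1) 0ℓ} (P? : Decidable P) →
                  e ^ 1 ≤ M * ∑ (tuples E 1) (𝟙 ∘ P?) → Σ (Point n d) λ y → y ∈ E × P (y ∷ [])
    some-vertex M P? dense = 0<∑-𝟙⇒∃ (λ y → P? (y ∷ [])) E (n≢0⇒n>0 λ ∑≡0 →
      contradiction (begin
        e                               ≡⟨ *-identityʳ e ⟨
        e ^ 1                           ≤⟨ dense ⟩
        M * ∑ (tuples E 1) (𝟙 ∘ P?)     ≡⟨ cong (M *_) (trans (∑-tuples-suc E 0 _) (∑-cong E λ y → +-identityʳ _)) ⟩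
        M * ∑[ y ← E ] 𝟙 (P? (y ∷ []))  ≡⟨ cong (M *_) ∑≡0 ⟩
        M * 0                           ≡⟨ *-zeroʳ M ⟩
        0                               ∎) (<⇒≱ (>-nonZero⁻¹ e)))
      where open ≤-Reasoning

    -- An arbitrary dense `P` is allowed because the induction replaces it by richness for `P`,
    -- which concerns one vertex fewer and has density at least 1/(2M). The types found there are
    -- then extended through their slices.
    many-types : .{{_ : NonZero e}} → ∀ j →
      (∀ {i} → i < j → n ^ suc i * ∑[ v ← tuples E (suc i) ] energy v E ≤ suc (suc i) * (e ^ suc i * (e * e))) →
      ∀ M {P : Pred (Vec (Point n d) (suc j)) 0ℓ} (P? : Decidable P) →
      e ^ suc j ≤ M * ∑ (tuples E (suc j)) (𝟙 ∘ P?) →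
      Σ (List (SimplexType j)) λ L →
        AllPairs DifferentTypes L × All (Realised E P) L × n ^ (suc j C 2) ≤ proportion M j * length L
    many-types zero _ M P? dense with y , y∈E , Py ← some-vertex M P? dense =
      (λ { zero zero () }) ∷ [] , [] ∷ [] ,
      realise (y ∷ []) Py (λ { zero → y∈E }) (λ { zero zero () }) ∷ [] , ≤-refl
    many-types (suc j) energies M P? dense =
      let
        L , L! , real , size = many-types j (λ i<j → energies (m≤n⇒m≤1+n i<j)) (2 * M) (rich? M P?)
                                 (many-rich j (energies ≤-refl) M P? dense)
        L′ , L′! , real′ , size′ , _ = extend-all {m = n ^ suc j} {4 * M * M * suc (suc j)} P? L! real
      in L′ , L′! , real′ ,
         size-step n j (proportion (2 * M) j) (4 * M * M * suc (suc j)) size size′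

-- Squaring the size hypothesis clears its roots and denominator, and the list of pairwise different
-- determined types witnesses the lower bound on |T_k(E)|.
theorem2p5 : (d k : ℕ) → 1 ≤ k → k ≤ d →
    Σ ℕ λ K → Σ ℕ λ M → Σ ℕ λ N₀ →
    (n : ℕ) .{{_ : NonZero n}} → N₀ ≤ n → ¬ (2 ∣ n) →
    (γ : ℕ) → Prime γ → γ ∣ n → ((q : ℕ) → Prime q → q ∣ n → γ ≤ q) →
    (E : List (Vec (Fin n) d)) → Unique E →
    K * K * τ n * n ^ (2 * d + k ∸ 1) ≤ length E * length E * γ ^ (d ∸ 1) →
    Σ (List (SimplexType k)) λ L →
    AllPairs DifferentTypes L × All (Determined n k E) L ×
    n ^ ((suc k) C 2) ≤ M * length L
theorem2p5 zero    (suc k) _ ()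
theorem2p5 (suc d) (suc k) _ _ = 1 , proportion 1 (suc k) , 0 , λ n _ n-odd γ γ-prime _ γ-least E E! large →
  let
    instance
      γ^d≢0 : NonZero (γ ^ d)
      γ^d≢0 = m^n≢0 γ d {{prime⇒nonZero γ-prime}}
      e≢0 : NonZero (length E)
      e≢0 = nonempty n E {γ ^ d} large
    L , L! , real , size = many-types E (suc k)
      -- The longest tuples have `suc k` points and need `b * n ^ k` to be at most |E|² γ^d, which
      -- is the squared hypothesis after `exponent`.
      (λ i<1+k → EnergyBound.∑-energy-E n-odd (λ h∣n → ^-weight-bound γ γ-least h∣n d) E!
                   (subst (_≤ length E * length E * γ ^ d) (exponent n d k) large) (s≤s⁻¹ i<1+k))
      1 {λ _ → ⊤} (λ _ → yes tt) (everything n E)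
  in L , L! , All.map (λ { (realise v _ v∈E t≡) → lookup v , v∈E , t≡ }) real , size
  where
  open ≤-Reasoning
  τ≢0 : ∀ n .{{_ : NonZero n}} → τ n ≢ 0
  τ≢0 n τ≡0 with divisors n | ∈-divisors {n} ∣-refl
  ... | _ ∷ _ | _ = contradiction τ≡0 λ ()
  nonempty : ∀ n .{{_ : NonZero n}} (E : List (Point n (suc d))) {c} →
             1 * 1 * τ n * n ^ (2 * suc d + suc k ∸ 1) ≤ length E * length E * c → NonZero (length E)
  nonempty n (_ ∷ _) large = _
  nonempty n []      large = contradiction (n≤0⇒n≡0 large) (≢-nonZero⁻¹ _ {{m*n≢0 (1 * 1 * τ n) (n ^ i)}})
    where
    i = 2 * suc d + suc k ∸ 1
    instance
      τn≢0 : NonZero (1 * 1 * τ n)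
      τn≢0 = ≢-nonZero (τ≢0 n ∘ trans (sym (*-identityˡ (τ n))))
      n^i≢0 : NonZero (n ^ i)
      n^i≢0 = m^n≢0 n i
  exponent : ∀ n d k → 1 * 1 * τ n * n ^ (2 * suc d + suc k ∸ 1) ≡ n ^ suc d * (τ n * n ^ suc d) * n ^ k
  exponent n d k = begin-equality
    1 * 1 * τ n * n ^ (2 * suc d + suc k ∸ 1)
      ≡⟨ cong₂ _*_ (*-identityˡ (τ n)) (cong (λ i → n ^ (i ∸ 1)) (+-suc (2 * suc d) k)) ⟩
    τ n * n ^ (2 * suc d + k)
      ≡⟨ cong (τ n *_) (trans (^-distribˡ-+-* n (2 * suc d) k) (cong (_* n ^ k)
           (trans (cong (λ i → n ^ (suc d + i)) (+-identityʳ (suc d))) (^-distribˡ-+-* n (suc d) (suc d))))) ⟩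
    τ n * (n ^ suc d * n ^ suc d * n ^ k)
      ≡⟨ shuffle (τ n) (n ^ suc d) (n ^ k) ⟩
    n ^ suc d * (τ n * n ^ suc d) * n ^ k
      ∎
    where
    shuffle : ∀ t p q → t * (p * p * q) ≡ p * (t * p) * q
    shuffle = solve-∀
  everything : ∀ n (E : List (Point n (suc d))) →
               length E ^ suc (suc k) ≤ 1 * ∑[ v ← tuples E (suc (suc k)) ] 1
  everything n E = ≤-reflexive (sym (trans (*-identityˡ _)
    (trans (sym (length≡∑ (tuples E (suc (suc k))))) (length-tuples E (suc (suc k))))))
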